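{- Let $\mathbf{X}$ be a represented space. The following are equivalent: (1) $\mathbf{X}$ is a computably discrete computably Quasi-Polish space. (2) There is an equivalence relation $R$ on $\mathbb{N}$ such that $\mathbb{N}/R$ is computably admissible and $\mathbf{X}$ is computably isomorphic to $\mathbb{N}/R$. (3) There is a computably enumerable equivalence relation (ceer) $R$ on $\mathbb{N}$ such that $\mathbf{X}$ is computably isomorphic to $\mathbb{N}/R$.
   Context: A represented space $\mathbf{X}=(X,\delta_{\mathbf{X}})$ is a set $X$ with a partial surjection $\delta_{\mathbf{X}}:\subseteq\mathbb{N}^{\mathbb{N}}\to X$; any $p$ with $\delta_{\mathbf X}(p)=x$ is a name of $x$. A realiser of a map $f:\mathbf{X}\to\mathbf{Y}$ is a partial map $R_f:\subseteq\mathbb{N}^{\mathbb{N}}\to\mathbb{N}^{\mathbb{N}}$ sending every name of every $x\in X$ to a name of $f(x)$; $f$ is computable (continuously realisable) if it has a computable (continuous) realiser. A computable isomorphism is a computable bijection with computable inverse. $\mathbb{N}$ is represented by $\delta_{\mathbb N}(p)=p(0)$. $\mathbf{Y}^{\mathbf{X}}$ is the represented space of total continuously realisable functions; a name of $f$ is a $p\in\mathbb N^{\mathbb N}$ coding a realiser of $f$, with $p(0)$ the index of a Turing machine using the oracle $n\mapsto p(n+1)$. In the product $\mathbf{X}\times\mathbf{Y}$, $p$ names $(x,y)$ iff $n\mapsto p(2n)$ names $x$ and $n\mapsto p(2n+1)$ names $y$. Sierpinski space $\mathbb{S}=\{\top,\bot\}$ is represented so that $0^\omega$ names $\bot$ and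 every other sequence names $\top$. The space $\mathcal{O}(\mathbf{X})$ of open sets is $\mathbb{S}^{\mathbf{X}}$, identifying $U$ with its characteristic function ($x\mapsto\top$ iff $x\in U$); $U$ is computably open if it is a computable point of $\mathcal O(\mathbf X)$ (i.e. has a computable name). $\mathbf{X}$ is computably discrete if the diagonal of $\mathbf X\times\mathbf X$ is computably open, i.e. equality is semidecidable. $\mathbf{X}$ is computably admissible if the map $\mathbf{X}\to\mathcal{O}(\mathcal{O}(\mathbf{X}))$, $x\mapsto\{U\in\mathcal{O}(\mathbf{X})\mid x\in U\}$, has a computable partial inverse (defined on its image). $\mathbf{X}$ is computably overt if non-emptiness of a given $U\in\mathcal{O}(\mathbf{X})$ is semidecidable, i.e. $\{U\in\mathcal O(\mathbf X)\mid U\neq\emptyset\}$ is computably open in $\mathcal{O}(\mathbf{X})$. For a transitive relation $\ll$ on $\mathbb{N}$, an ideal is a non-empty $I\subseteq\mathbb{N}$ such that $x\ll y\in I$ implies $x\in I$, and for all $x,y\in I$ there is $z\in I$ with $x\ll z$ and $y\ll z$. $\mathbf{I}(\ll)$ is the represented space of ideals, where $p$ names $I$ iff $I=\{p(k)\mid k\in\mathbb{N}\}$. A represented space is precomputably Quasi-Polish if it is computably isomorphic to $\mathbf{I}(\ll)$ for some computably enumerable transitive relation $\ll$ on $\mathbb N$; it is computably Quasi-Polish if it is moreover computably overt. For an equivalence relation $R$ on $\mathbb{N}$, the quotient $\mathbb{N}/R$ is the represented space of $R$-classes where a name of a class is a name of any of its elements.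
   Formalization: The formal theorem assumes that X is non-empty; for X = ∅ the claim fails, since the empty relation has no ideals, so (1) holds, while N/R is never empty, so (2) and (3) fail. -}

module Defs where

open import Axiom.ExcludedMiddle using (ExcludedMiddle)
open import Data.Bool.Base using (Bool; true; false)
open import Data.Nat.Base hiding (_⊔_; _^_)
open import Data.Nat.Properties
open import Data.Product.Base using (∃; ∃-syntax; Σ-syntax; _×_; _,_; proj₁; proj₂; map₂)
open import Data.Product.Relation.Binary.Pointwise.NonDependent using (×-setoid)
open import Data.Sum.Base using (_⊎_; inj₁; inj₂)
open import Function.Base using (_∘_)
open import Function.Bundles using (Func; Inverse; Equivalence; _⇔_; mk⇔)
open import Level using (Level; 0ℓ; _⊔_) renaming (suc to lsuc)
open import Relation.Binary.Bundles using (Setoid)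
open import Relation.Binary.Core using (Rel; REL)
open import Relation.Binary.Definitions using (Transitive; tri<; tri≈; tri>)
open import Relation.Binary.PropositionalEquality
  using (_≡_; refl; sym; trans; cong; cong₂; subst; _≗_)
import Relation.Binary.PropositionalEquality as ≡
open import Relation.Binary.Structures using (IsEquivalence)
open import Relation.Nullary.Decidable.Core using (Dec; yes; no)
open import Relation.Nullary.Negation.Core using (¬_; contradiction)
open import Relation.Unary using (Pred; _∈_; _≐_)

private
  variable
    c ℓ r c₁ ℓ₁ r₁ c₂ ℓ₂ r₂ g a : Level

triangle : ℕ → ℕ
triangle zero    = zero
triangle (suc n) = suc n + triangle n

-- Cantor's pairing, with inverse unpair.  Opaque so that unification can
-- recover a and b from ⟪ a , b ⟫.
opaque
  ⟪_,_⟫ : ℕ → ℕ → ℕ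
  ⟪ a , b ⟫ = a + triangle (a + b)

-- The successor of a pair in the enumeration along antidiagonals.
next : ℕ × ℕ → ℕ × ℕ
next (a , zero)  = zero , suc a
next (a , suc b) = suc a , b

unpair : ℕ → ℕ × ℕ
unpair zero    = zero , zero
unpair (suc n) = next (unpair n)

unpair-pair′ : ∀ s a b → a + b ≡ s → unpair (a + triangle s) ≡ (a , b)
unpair-pair′ zero    zero    zero    _  = refl
unpair-pair′ (suc s) zero    (suc b) eq =
  trans (cong next (unpair-pair′ s s zero (+-identityʳ s)))
        (cong (zero ,_) (sym eq))
unpair-pair′ s       (suc a) b       eq =
  cong next (unpair-pair′ s a (suc b) (trans (+-suc a b) eq))

opaque
  unfolding ⟪_,_⟫

  unpair-pair : ∀ a b → unpair ⟪ a , b ⟫ ≡ (a , b)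
  unpair-pair a b = unpair-pair′ (a + b) a b refl

  pair-next : ∀ x → ⟪ proj₁ (next x) , proj₂ (next x) ⟫ ≡ suc ⟪ proj₁ x , proj₂ x ⟫
  pair-next (a , zero)  rewrite +-identityʳ a = refl
  pair-next (a , suc b) rewrite +-suc a b     = refl

  pair-unpair : ∀ n → ⟪ proj₁ (unpair n) , proj₂ (unpair n) ⟫ ≡ n
  pair-unpair zero    = refl
  pair-unpair (suc n) = trans (pair-next (unpair n)) (cong suc (pair-unpair n))

n≤triangle : ∀ n → n ≤ triangle n
n≤triangle zero    = z≤n
n≤triangle (suc n) = m≤m+n (suc n) (triangle n)

b≤triangle : ∀ a b → b ≤ triangle (a + b)
b≤triangle a b = ≤-trans (m≤n+m b a) (n≤triangle (a + b))

opaque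
  unfolding ⟪_,_⟫

  a≤pair : ∀ a b → a ≤ ⟪ a , b ⟫
  a≤pair a b = m≤m+n a (triangle (a + b))

  b≤pair : ∀ a b → b ≤ ⟪ a , b ⟫
  b≤pair a b = ≤-trans (b≤triangle a b) (m≤n+m (triangle (a + b)) a)

  b<pair : ∀ a b → b < ⟪ suc a , b ⟫
  b<pair a b = s≤s (≤-trans (b≤triangle (suc a) b) (m≤n+m (triangle (suc a + b)) a))

Baire : Set
Baire = ℕ → ℕ

-- Programs for oracle machines, given by Kleene's schemes for the partial
-- functions that are recursive in an oracle.  All functions are unary;
-- several arguments are packed with ⟪_,_⟫.
data Code : Set where
  zero succ left right oracle : Code
  pair comp prec              : Code → Code → Code
  rfind                       : Code → Code

-- c ⟦ α ⟧ x ⇓ y : with oracle α and input x, program c halts with output y.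
infix 4 _⟦_⟧_⇓_

data _⟦_⟧_⇓_ : Code → Baire → ℕ → ℕ → Set where
  ⇓zero      : ∀ {α x} → zero ⟦ α ⟧ x ⇓ 0
  ⇓succ      : ∀ {α x} → succ ⟦ α ⟧ x ⇓ suc x
  ⇓left      : ∀ {α x} → left ⟦ α ⟧ x ⇓ proj₁ (unpair x)
  ⇓right     : ∀ {α x} → right ⟦ α ⟧ x ⇓ proj₂ (unpair x)
  ⇓oracle    : ∀ {α x} → oracle ⟦ α ⟧ x ⇓ α x
  ⇓pair      : ∀ {α c d x y z} → c ⟦ α ⟧ x ⇓ y → d ⟦ α ⟧ x ⇓ z →
               pair c d ⟦ α ⟧ x ⇓ ⟪ y , z ⟫
  ⇓comp      : ∀ {α c d x y z} → d ⟦ α ⟧ x ⇓ y → c ⟦ α ⟧ y ⇓ z →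
               comp c d ⟦ α ⟧ x ⇓ z
  ⇓prec-zero : ∀ {α c d x a y} → unpair x ≡ (a , zero) →
               c ⟦ α ⟧ a ⇓ y → prec c d ⟦ α ⟧ x ⇓ y
  ⇓prec-suc  : ∀ {α c d x a n y z} → unpair x ≡ (a , suc n) →
               prec c d ⟦ α ⟧ ⟪ a , n ⟫ ⇓ y → d ⟦ α ⟧ ⟪ a , ⟪ n , y ⟫ ⟫ ⇓ z →
               prec c d ⟦ α ⟧ x ⇓ z
  -- n is the least zero of c ⟪ x ,_⟫, and c is defined below n with the
  -- positive values suc (v m).
  ⇓rfind     : ∀ {α c x n} (v : ℕ → ℕ) →
               (∀ m → m < n → c ⟦ α ⟧ ⟪ x , m ⟫ ⇓ suc (v m)) →
               c ⟦ α ⟧ ⟪ x , n ⟫ ⇓ 0 → rfind c ⟦ α ⟧ x ⇓ n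

⇓-cast : ∀ {e α x y z} → y ≡ z → e ⟦ α ⟧ x ⇓ y → e ⟦ α ⟧ x ⇓ z
⇓-cast refl h = h

⇓-deterministic : ∀ {e α x y z} → e ⟦ α ⟧ x ⇓ y → e ⟦ α ⟧ x ⇓ z → y ≡ z
⇓-deterministic ⇓zero   ⇓zero   = refl
⇓-deterministic ⇓succ   ⇓succ   = refl
⇓-deterministic ⇓left   ⇓left   = refl
⇓-deterministic ⇓right  ⇓right  = refl
⇓-deterministic ⇓oracle ⇓oracle = refl
⇓-deterministic (⇓pair p q) (⇓pair p′ q′) =
  cong₂ ⟪_,_⟫ (⇓-deterministic p p′) (⇓-deterministic q q′)
⇓-deterministic (⇓comp p q) (⇓comp p′ q′)
  with refl ← ⇓-deterministic p p′ = ⇓-deterministic q q′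
⇓-deterministic (⇓prec-zero eq p) (⇓prec-zero eq′ p′)
  with refl ← trans (sym eq) eq′ = ⇓-deterministic p p′
⇓-deterministic (⇓prec-zero eq _) (⇓prec-suc eq′ _ _)
  with () ← trans (sym eq) eq′
⇓-deterministic (⇓prec-suc eq _ _) (⇓prec-zero eq′ _)
  with () ← trans (sym eq) eq′
⇓-deterministic (⇓prec-suc eq p q) (⇓prec-suc eq′ p′ q′)
  with refl ← trans (sym eq) eq′
  with refl ← ⇓-deterministic p p′ = ⇓-deterministic q q′
⇓-deterministic (⇓rfind {n = n} v f p) (⇓rfind {n = n′} v′ f′ p′) with <-cmp n n′
... | tri≈ _ n≡n′ _ = n≡n′
... | tri< n<n′ _ _ with () ← ⇓-deterministic p (f′ n n<n′)
... | tri> _ _ n′<n with () ← ⇓-deterministic (f n′ n′<n) p′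

-- The first argument of decodeWith bounds the recursion depth; components
-- of a compound code have smaller indices, so the bound in decode suffices.
decodeWith : ℕ → ℕ → Code
decodeTag  : ℕ → ℕ × ℕ → Code

decodeWith zero       n = zero
decodeWith (suc fuel) n = decodeTag fuel (unpair n)

decodeTag fuel (0 , k) = zero
decodeTag fuel (1 , k) = succ
decodeTag fuel (2 , k) = left
decodeTag fuel (3 , k) = right
decodeTag fuel (4 , k) = oracle
decodeTag fuel (5 , k) =
  pair (decodeWith fuel (proj₁ (unpair k))) (decodeWith fuel (proj₂ (unpair k)))
decodeTag fuel (6 , k) =
  comp (decodeWith fuel (proj₁ (unpair k))) (decodeWith fuel (proj₂ (unpair k)))
decodeTag fuel (7 , k) =
  prec (decodeWith fuel (proj₁ (unpair k))) (decodeWith fuel (proj₂ (unpair k)))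
decodeTag fuel (_ , k) = rfind (decodeWith fuel k)

decode : ℕ → Code
decode n = decodeWith (suc n) n

encode : Code → ℕ
encode zero       = ⟪ 0 , 0 ⟫
encode succ       = ⟪ 1 , 0 ⟫
encode left       = ⟪ 2 , 0 ⟫
encode right      = ⟪ 3 , 0 ⟫
encode oracle     = ⟪ 4 , 0 ⟫
encode (pair c d) = ⟪ 5 , ⟪ encode c , encode d ⟫ ⟫
encode (comp c d) = ⟪ 6 , ⟪ encode c , encode d ⟫ ⟫
encode (prec c d) = ⟪ 7 , ⟪ encode c , encode d ⟫ ⟫
encode (rfind c)  = ⟪ 8 , encode c ⟫

fuelˡ : ∀ {f} t a b → ⟪ suc t , ⟪ a , b ⟫ ⟫ ≤ f → a < f
fuelˡ t a b le = ≤-trans (s≤s (a≤pair a b)) (≤-trans (b<pair t ⟪ a , b ⟫) le)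

fuelʳ : ∀ {f} t a b → ⟪ suc t , ⟪ a , b ⟫ ⟫ ≤ f → b < f
fuelʳ t a b le = ≤-trans (s≤s (b≤pair a b)) (≤-trans (b<pair t ⟪ a , b ⟫) le)

decodeWith-encode : ∀ c f → encode c < f → decodeWith f (encode c) ≡ c
decodeWith-encode zero       (suc f) _ rewrite unpair-pair 0 0 = refl
decodeWith-encode succ       (suc f) _ rewrite unpair-pair 1 0 = refl
decodeWith-encode left       (suc f) _ rewrite unpair-pair 2 0 = refl
decodeWith-encode right      (suc f) _ rewrite unpair-pair 3 0 = refl
decodeWith-encode oracle     (suc f) _ rewrite unpair-pair 4 0 = refl
decodeWith-encode (pair c d) (suc f) (s≤s le)
  rewrite unpair-pair 5 ⟪ encode c , encode d ⟫ | unpair-pair (encode c) (encode d) =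
  cong₂ pair (decodeWith-encode c f (fuelˡ 4 (encode c) (encode d) le))
             (decodeWith-encode d f (fuelʳ 4 (encode c) (encode d) le))
decodeWith-encode (comp c d) (suc f) (s≤s le)
  rewrite unpair-pair 6 ⟪ encode c , encode d ⟫ | unpair-pair (encode c) (encode d) =
  cong₂ comp (decodeWith-encode c f (fuelˡ 5 (encode c) (encode d) le))
             (decodeWith-encode d f (fuelʳ 5 (encode c) (encode d) le))
decodeWith-encode (prec c d) (suc f) (s≤s le)
  rewrite unpair-pair 7 ⟪ encode c , encode d ⟫ | unpair-pair (encode c) (encode d) =
  cong₂ prec (decodeWith-encode c f (fuelˡ 6 (encode c) (encode d) le))
             (decodeWith-encode d f (fuelʳ 6 (encode c) (encode d) le))
decodeWith-encode (rfind c)  (suc f) (s≤s le)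
  rewrite unpair-pair 8 (encode c) =
  cong rfind (decodeWith-encode c f (≤-trans (b<pair 7 (encode c)) le))

decode-encode : ∀ c → decode (encode c) ≡ c
decode-encode c = decodeWith-encode c (suc (encode c)) ≤-refl

0ω : Baire
0ω _ = 0

infixr 5 _∷_

_∷_ : ℕ → Baire → Baire
(n ∷ p) zero    = n
(n ∷ p) (suc k) = p k

tail : Baire → Baire
tail p n = p (suc n)

-- interleave p q (2 * n) is p n and interleave p q (1 + 2 * n) is q n.
interleave : Baire → Baire → Baire
interleave p q zero    = p zero
interleave p q (suc n) = interleave q (tail p) n

Agree : ℕ → Rel Baire 0ℓ
Agree m p q = ∀ i → i < m → p i ≡ q i

-- Taking p′ = p shows that the values of such a G are unique up to _≗_, so
-- that G is the graph of a partial function, continuous on its domain.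
Continuous : REL Baire Baire g → Set g
Continuous G = ∀ {p q} → G p q → ∀ n →
               ∃[ m ] (∀ {p′ q′} → G p′ q′ → Agree m p p′ → q n ≡ q′ n)

Φ : Code → REL Baire Baire 0ℓ
Φ c p q = ∀ n → c ⟦ p ⟧ n ⇓ q n

-- The partial function coded by a point of Baire space, whose head is the
-- index of a machine that has access to the tail and to the argument.
Coded : Baire → REL Baire Baire 0ℓ
Coded p q = Φ (decode (p 0)) (interleave (tail p) q)

ComputableSequence : Baire → Set
ComputableSequence p = ∃[ c ] Φ c 0ω p

ComputablyEnumerable : Rel ℕ a → Set a
ComputablyEnumerable R =
  ∃[ c ] (∀ m n → R m n ⇔ (∃[ v ] c ⟦ 0ω ⟧ ⟪ m , n ⟫ ⇓ v))

Φ⇒Coded : ∀ e α {q s} → Φ e (interleave α q) s → Coded (encode e ∷ α) q s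
Φ⇒Coded e α {q} {s} = subst (λ c → Φ c (interleave α q) s) (sym (decode-encode e))

Agree-mono : ∀ {k m p q} → k ≤ m → Agree m p q → Agree k p q
Agree-mono k≤m h i i<k = h i (≤-trans i<k k≤m)

Agree-interleave : ∀ m {p p′ q q′} → Agree m p p′ → Agree m q q′ →
                   Agree m (interleave p q) (interleave p′ q′)
Agree-interleave (suc m) hp hq zero    _         = hp zero (s≤s z≤n)
Agree-interleave (suc m) hp hq (suc i) (s≤s i<m) =
  Agree-interleave m (Agree-mono (n≤1+n m) hq) (λ j j<m → hp (suc j) (s≤s j<m)) i i<m

commonBound : (P : ℕ → ℕ → Set) → (∀ {i k m} → k ≤ m → P i k → P i m) →
              ∀ n → (∀ i → i < n → ∃[ k ] P i k) → ∃[ k ] (∀ i → i < n → P i k)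
commonBound P mono zero    _ = 0 , λ _ ()
commonBound P mono (suc n) f =
  let k , h = commonBound P mono n (λ i i<n → f i (m<n⇒m<1+n i<n))
      l , e = f n ≤-refl
  in k + l , λ i i<1+n → choose k l h e i (m≤n⇒m<n∨m≡n (s≤s⁻¹ i<1+n))
  where
  choose : ∀ k l → (∀ i → i < n → P i k) → P n l →
           ∀ i → i < n ⊎ i ≡ n → P i (k + l)
  choose k l h e i (inj₁ i<n)  = mono (m≤m+n k l) (h i i<n)
  choose k l h e i (inj₂ refl) = mono (m≤n+m l k) e

⇓-finite-use : ∀ {e α x y} → e ⟦ α ⟧ x ⇓ y →
               ∃[ m ] (∀ {β} → Agree m α β → e ⟦ β ⟧ x ⇓ y)
⇓-finite-use ⇓zero  = 0 , λ _ → ⇓zero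
⇓-finite-use ⇓succ  = 0 , λ _ → ⇓succ
⇓-finite-use ⇓left  = 0 , λ _ → ⇓left
⇓-finite-use ⇓right = 0 , λ _ → ⇓right
⇓-finite-use (⇓oracle {x = x}) =
  suc x , λ h → ⇓-cast (sym (h x ≤-refl)) ⇓oracle
⇓-finite-use (⇓pair p q) with ⇓-finite-use p | ⇓-finite-use q
... | k , f | m , g =
  k + m , λ h → ⇓pair (f (Agree-mono (m≤m+n k m) h)) (g (Agree-mono (m≤n+m m k) h))
⇓-finite-use (⇓comp p q) with ⇓-finite-use p | ⇓-finite-use q
... | k , f | m , g =
  k + m , λ h → ⇓comp (f (Agree-mono (m≤m+n k m) h)) (g (Agree-mono (m≤n+m m k) h))
⇓-finite-use (⇓prec-zero eq p) = map₂ (λ f h → ⇓prec-zero eq (f h)) (⇓-finite-use p)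
⇓-finite-use (⇓prec-suc eq p q) with ⇓-finite-use p | ⇓-finite-use q
... | k , f | m , g =
  k + m , λ h → ⇓prec-suc eq (f (Agree-mono (m≤m+n k m) h)) (g (Agree-mono (m≤n+m m k) h))
⇓-finite-use {α = α} (⇓rfind {c = c} {x = x} {n = n} v f p)
  with commonBound (λ i k → ∀ {β} → Agree k α β → c ⟦ β ⟧ ⟪ x , i ⟫ ⇓ suc (v i))
                   (λ k≤m F h → F (Agree-mono k≤m h))
                   n (λ i i<n → ⇓-finite-use (f i i<n))
     | ⇓-finite-use p
... | k , F | m , g =
  k + m , λ h → ⇓rfind v (λ i i<n → F i i<n (Agree-mono (m≤m+n k m) h))
                         (g (Agree-mono (m≤n+m m k) h))

Φ-continuous : ∀ e → Continuous (Φ e)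
Φ-continuous e {p} {q} Φpq n with ⇓-finite-use (Φpq n)
... | m , use = m , λ Φp′q′ h → ⇓-deterministic (use h) (Φp′q′ n)

Coded-continuous : ∀ q → Continuous (λ p → Coded p q)
Coded-continuous q {p} Cp n with Φ-continuous (decode (p 0)) Cp n
... | m , use = suc m , λ {p′} {s} Cp′ h →
  use (subst (λ i → Φ (decode i) (interleave (tail p′) q) s) (sym (h 0 (s≤s z≤n))) Cp′)
      (Agree-interleave m (λ i i<m → h (suc i) (s≤s i<m)) (λ _ _ → refl))

Agree-prefix : ∀ {m p q} → p ≗ q → Agree m p q
Agree-prefix h i _ = h i

Φ-resp : ∀ e {p p′ q} → p ≗ p′ → Φ e p q → Φ e p′ q
Φ-resp e h Φpq n = proj₂ (⇓-finite-use (Φpq n)) (Agree-prefix h)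

Coded-resp : ∀ {p p′ q q′ s} → p ≗ p′ → q ≗ q′ → Coded p q s → Coded p′ q′ s
Coded-resp {p} {p′} {q} {q′} {s} h k Cpq =
  subst (λ i → Φ (decode i) (interleave (tail p′) q′) s) (h 0)
    (Φ-resp (decode (p 0))
      (λ i → Agree-interleave (suc i) (λ j _ → h (suc j)) (λ j _ → k j) i ≤-refl) Cpq)

-- The set is a setoid; p ⊩ x says that p is a name of x.
record RepresentedSpace c ℓ r : Set (lsuc (c ⊔ ℓ ⊔ r)) where
  infix 4 _⊩_
  field
    setoid       : Setoid c ℓ
  open Setoid setoid public using (Carrier; _≈_)
  field
    _⊩_          : REL Baire Carrier r
    ⊩-resp       : ∀ {p q x y} → p ≗ q → x ≈ y → p ⊩ x → q ⊩ y
    ⊩-functional : ∀ {p x y} → p ⊩ x → p ⊩ y → x ≈ y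
    ⊩-surjective : ∀ x → ∃[ p ] p ⊩ x

open RepresentedSpace using (setoid; Carrier)

_∋_≈_ : (X : RepresentedSpace c ℓ r) → Rel (Carrier X) ℓ
X ∋ x ≈ y = RepresentedSpace._≈_ X x y

_∋_⊩_ : (X : RepresentedSpace c ℓ r) → REL Baire (Carrier X) r
X ∋ p ⊩ x = RepresentedSpace._⊩_ X p x

Map : RepresentedSpace c₁ ℓ₁ r₁ → RepresentedSpace c₂ ℓ₂ r₂ → Set (c₁ ⊔ ℓ₁ ⊔ c₂ ⊔ ℓ₂)
Map X Y = Func (setoid X) (setoid Y)

module _ (X : RepresentedSpace c₁ ℓ₁ r₁) (Y : RepresentedSpace c₂ ℓ₂ r₂) where

  Realises : REL Baire Baire g → (Carrier X → Carrier Y) → Set (c₁ ⊔ r₁ ⊔ r₂ ⊔ g)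
  Realises G f = ∀ p x → X ∋ p ⊩ x → ∃[ q ] (G p q × Y ∋ q ⊩ f x)

  Computable : (Carrier X → Carrier Y) → Set (c₁ ⊔ r₁ ⊔ r₂)
  Computable f = ∃[ e ] Realises (Φ e) f

  ContinuouslyRealisable : (Carrier X → Carrier Y) → Set (lsuc 0ℓ ⊔ c₁ ⊔ r₁ ⊔ r₂)
  ContinuouslyRealisable f =
    Σ[ G ∈ REL Baire Baire 0ℓ ] (Continuous G × Realises G f)

infix 4 _≅_

record _≅_ (X : RepresentedSpace c₁ ℓ₁ r₁) (Y : RepresentedSpace c₂ ℓ₂ r₂) :
           Set (c₁ ⊔ ℓ₁ ⊔ r₁ ⊔ c₂ ⊔ ℓ₂ ⊔ r₂) where
  field
    inverse : Inverse (setoid X) (setoid Y)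
  open Inverse inverse public using (to; from)
  field
    to-computable   : Computable X Y to
    from-computable : Computable Y X from

ComputablePoint : (X : RepresentedSpace c ℓ r) → Carrier X → Set r
ComputablePoint X x = ∃[ p ] (ComputableSequence p × X ∋ p ⊩ x)

interleave-even : ∀ p q n → interleave p q (2 * n) ≡ p n
interleave-even p q zero    = refl
interleave-even p q (suc n) rewrite +-suc n (n + 0) = interleave-even (tail p) (tail q) n

interleave-odd : ∀ p q n → interleave p q (suc (2 * n)) ≡ q n
interleave-odd p q n = interleave-even q (tail p) n

infixr 2 _⊗_

_⊗_ : RepresentedSpace c₁ ℓ₁ r₁ → RepresentedSpace c₂ ℓ₂ r₂ →
      RepresentedSpace (c₁ ⊔ c₂) (ℓ₁ ⊔ ℓ₂) (r₁ ⊔ r₂)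
X ⊗ Y = record
  { setoid       = ×-setoid (setoid X) (setoid Y)
  ; _⊩_          = λ p (x , y) → X ∋ (λ n → p (2 * n)) ⊩ x × Y ∋ (λ n → p (suc (2 * n))) ⊩ y
  ; ⊩-resp       = λ p≗q (x≈x′ , y≈y′) (px , py) →
                     X.⊩-resp (λ n → p≗q (2 * n)) x≈x′ px ,
                     Y.⊩-resp (λ n → p≗q (suc (2 * n))) y≈y′ py
  ; ⊩-functional = λ (px , py) (px′ , py′) → X.⊩-functional px px′ , Y.⊩-functional py py′
  ; ⊩-surjective = λ (x , y) →
      let p , px = X.⊩-surjective x
          q , qy = Y.⊩-surjective y
      in interleave p q ,
         X.⊩-resp (λ n → sym (interleave-even p q n)) X.refl px ,
         Y.⊩-resp (λ n → sym (interleave-odd p q n)) Y.refl qy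
  }
  where
  module X where
    open RepresentedSpace X public
    open Setoid (setoid X) public using (refl)
  module Y where
    open RepresentedSpace Y public
    open Setoid (setoid Y) public using (refl)

ℕ/ : (R : Rel ℕ a) → IsEquivalence R → RepresentedSpace 0ℓ a a
ℕ/ R isEquivalence = record
  { setoid       = record { isEquivalence = isEquivalence }
  ; _⊩_          = λ p n → R (p 0) n
  ; ⊩-resp       = λ p≗q m≈n pm → R.trans (R.reflexive (sym (p≗q 0))) (R.trans pm m≈n)
  ; ⊩-functional = λ pm pn → R.trans (R.sym pm) pn
  ; ⊩-surjective = λ n → (λ _ → n) , R.refl
  }
  where module R = IsEquivalence isEquivalence

-- ⊤ is true and ⊥ is false.
infix 4 _⊩𝕊_

_⊩𝕊_ : REL Baire Bool 0ℓ
p ⊩𝕊 true  = ¬ (p ≗ 0ω)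
p ⊩𝕊 false = p ≗ 0ω

𝕊 : RepresentedSpace 0ℓ 0ℓ 0ℓ
𝕊 = record
  { setoid       = ≡.setoid Bool
  ; _⊩_          = _⊩𝕊_
  ; ⊩-resp       = resp
  ; ⊩-functional = functional
  ; ⊩-surjective = λ { true → (λ _ → 1) , (λ h → 1+n≢0 (h 0)) ; false → 0ω , λ _ → refl }
  }
  where
  resp : ∀ {p q x y} → p ≗ q → x ≡ y → p ⊩𝕊 x → q ⊩𝕊 y
  resp {x = true}  p≗q refl h = λ q≗0 → h (λ n → trans (p≗q n) (q≗0 n))
  resp {x = false} p≗q refl h = λ n → trans (sym (p≗q n)) (h n)

  functional : ∀ {p x y} → p ⊩𝕊 x → p ⊩𝕊 y → x ≡ y
  functional {x = true}  {true}  _ _ = refl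
  functional {x = true}  {false} h k = contradiction k h
  functional {x = false} {true}  h k = contradiction h k
  functional {x = false} {false} _ _ = refl

-- prefix p m determines the first m values of p.
prefix : Baire → ℕ → ℕ
prefix p zero    = 0
prefix p (suc m) = ⟪ p m , prefix p m ⟫

pair-injective : ∀ {a b a′ b′} → ⟪ a , b ⟫ ≡ ⟪ a′ , b′ ⟫ → (a , b) ≡ (a′ , b′)
pair-injective {a} {b} {a′} {b′} eq =
  trans (sym (unpair-pair a b)) (trans (cong unpair eq) (unpair-pair a′ b′))

prefix⇒Agree : ∀ {p q} m → prefix p m ≡ prefix q m → Agree m p q
prefix⇒Agree {p} {q} (suc m) eq i i<1+m with m≤n⇒m<n∨m≡n (s≤s⁻¹ i<1+m)
... | inj₁ i<m  = prefix⇒Agree {p} {q} m (cong proj₂ (pair-injective eq)) i i<m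
... | inj₂ refl = cong proj₁ (pair-injective eq)

least : (f : ℕ → ℕ) → ∀ n → f n ≡ 0 →
        ∃[ m ] (f m ≡ 0 × (∀ i → i < m → f i ≡ suc (pred (f i))))
least f zero    eq = 0 , eq , λ _ ()
least f (suc n) eq with f 0 in eq₀
... | zero  = 0 , eq₀ , λ _ ()
... | suc v with least (f ∘ suc) n eq
...   | m , fm , below = suc m , fm , below′
  where
  below′ : ∀ i → i < suc m → f i ≡ suc (pred (f i))
  below′ zero    _         = trans eq₀ (cong (suc ∘ pred) (sym eq₀))
  below′ (suc i) (s≤s i<m) = below i i<m

-- With oracle interleave α q and input n, search finds the least m such that
-- α answers query 0 about n and the first m values of q with 0, and returns
-- the answer of α to query 1 about them.
identity one double readArgument prefixCode query₀ query₁ search : Code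
identity     = pair left right
one          = comp succ zero
double       = comp (prec zero (comp succ (comp succ (comp right right)))) (pair zero identity)
readArgument = comp oracle (comp succ double)
prefixCode   = prec zero (pair (comp readArgument (comp left right)) (comp right right))
query₀       = comp oracle (comp double (pair zero (pair identity prefixCode)))
query₁       = comp oracle (comp double (pair one (pair identity prefixCode)))
search       = comp query₁ (pair identity (rfind query₀))

⇓identity : ∀ {α} n → identity ⟦ α ⟧ n ⇓ n
⇓identity n = ⇓-cast (pair-unpair n) (⇓pair ⇓left ⇓right)

⇓left′ : ∀ {α} a b → left ⟦ α ⟧ ⟪ a , b ⟫ ⇓ a
⇓left′ a b = ⇓-cast (cong proj₁ (unpair-pair a b)) ⇓left

⇓right′ : ∀ {α} a b → right ⟦ α ⟧ ⟪ a , b ⟫ ⇓ b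
⇓right′ a b = ⇓-cast (cong proj₂ (unpair-pair a b)) ⇓right

⇓double : ∀ {α} n → double ⟦ α ⟧ n ⇓ 2 * n
⇓double {α} n = ⇓comp (⇓pair ⇓zero (⇓identity n)) (loop n)
  where
  loop : ∀ k → prec zero (comp succ (comp succ (comp right right))) ⟦ α ⟧ ⟪ 0 , k ⟫ ⇓ 2 * k
  loop zero    = ⇓prec-zero (unpair-pair 0 0) ⇓zero
  loop (suc k) =
    ⇓prec-suc (unpair-pair 0 (suc k)) (loop k)
      (⇓-cast (cong suc (sym (+-suc k (k + 0))))
        (⇓comp (⇓comp (⇓comp (⇓right′ 0 _) (⇓right′ k _)) ⇓succ) ⇓succ))

module _ (α q : Baire) where

  ⇓readArgument : ∀ n → readArgument ⟦ interleave α q ⟧ n ⇓ q n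
  ⇓readArgument n = ⇓-cast (interleave-odd α q n)
    (⇓comp (⇓comp (⇓double n) ⇓succ) ⇓oracle)

  ⇓prefix : ∀ n m → prefixCode ⟦ interleave α q ⟧ ⟪ n , m ⟫ ⇓ prefix q m
  ⇓prefix n zero    = ⇓prec-zero (unpair-pair n 0) ⇓zero
  ⇓prefix n (suc m) = ⇓prec-suc (unpair-pair n (suc m)) (⇓prefix n m)
    (⇓pair (⇓comp (⇓comp (⇓right′ n _) (⇓left′ m _)) (⇓readArgument m))
           (⇓comp (⇓right′ n _) (⇓right′ m _)))

  ⇓query : ∀ {d t} n m → d ⟦ interleave α q ⟧ ⟪ n , m ⟫ ⇓ t →
           comp oracle (comp double (pair d (pair identity prefixCode)))
             ⟦ interleave α q ⟧ ⟪ n , m ⟫ ⇓ α ⟪ t , ⟪ ⟪ n , m ⟫ , prefix q m ⟫ ⟫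
  ⇓query n m tag = ⇓-cast (interleave-even α q _)
    (⇓comp (⇓comp (⇓pair tag (⇓pair (⇓identity _) (⇓prefix n m))) (⇓double _)) ⇓oracle)

  ⇓search : ∀ {n y} m → α ⟪ 0 , ⟪ ⟪ n , m ⟫ , prefix q m ⟫ ⟫ ≡ 0 →
            (∀ k → α ⟪ 0 , ⟪ ⟪ n , k ⟫ , prefix q k ⟫ ⟫ ≡ 0 →
                   α ⟪ 1 , ⟪ ⟪ n , k ⟫ , prefix q k ⟫ ⟫ ≡ y) →
            search ⟦ interleave α q ⟧ n ⇓ y
  ⇓search {n} {y} m found value
    with least (λ k → α ⟪ 0 , ⟪ ⟪ n , k ⟫ , prefix q k ⟫ ⟫) m found
  ... | k , zeroAt , below =
    ⇓comp (⇓pair (⇓identity n)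
            (⇓rfind _ (λ i i<k → ⇓-cast (below i i<k) (⇓query n i ⇓zero))
                      (⇓-cast zeroAt (⇓query n k ⇓zero))))
          (⇓-cast (value k zeroAt) (⇓query n k (⇓comp ⇓zero ⇓succ)))

-- Excluded middle is used for the surjectivity of the representations of
-- Y ^ X and 𝐈 _≪_.
module _ (em : ExcludedMiddle 0ℓ) where

  private
    Determined : REL Baire Baire 0ℓ → ℕ → ℕ → ℕ → ℕ → Set
    Determined G n m σ v = ∀ p q → G p q → prefix p m ≡ σ → q n ≡ v

    answer : ∀ {P : ℕ → Set} → ℕ → Dec (∃ P) → ℕ
    answer zero    (yes _)       = 0
    answer zero    (no  _)       = 1
    answer (suc _) (yes (v , _)) = v
    answer (suc _) (no  _)       = 0

    associate : REL Baire Baire 0ℓ → Baire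
    associate G x =
      let t  , y = unpair x
          nm , σ = unpair y
          n  , m = unpair nm
      in answer t (em {P = ∃ (Determined G n m σ)})

    associate-pair : ∀ G t n m σ → associate G ⟪ t , ⟪ ⟪ n , m ⟫ , σ ⟫ ⟫ ≡
                                   answer t (em {P = ∃ (Determined G n m σ)})
    associate-pair G t n m σ
      rewrite unpair-pair t ⟪ ⟪ n , m ⟫ , σ ⟫ | unpair-pair ⟪ n , m ⟫ σ | unpair-pair n m = refl

  Continuous⇒Coded : ∀ {G} → Continuous G → ∃[ p ] (∀ {q s} → G q s → Coded p q s)
  Continuous⇒Coded {G} continuous =
    encode search ∷ associate G , λ Gqs → Φ⇒Coded search (associate G) (code Gqs)
    where
    code : ∀ {q s} → G q s → Φ search (interleave (associate G) q) s
    code {q} {s} Gqs n with continuous Gqs n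
    ... | m , modulus = ⇓search (associate G) q m
      (trans (associate-pair G 0 n m (prefix q m)) found)
      (λ k eq → trans (associate-pair G 1 n k (prefix q k))
                      (value k (trans (sym (associate-pair G 0 n k (prefix q k))) eq)))
      where
      found : answer 0 (em {P = ∃ (Determined G n m (prefix q m))}) ≡ 0
      found with em {P = ∃ (Determined G n m (prefix q m))}
      ... | yes _ = refl
      ... | no ¬d = contradiction
        (s n , λ p′ s′ G′ eq → sym (modulus G′ (prefix⇒Agree m (sym eq)))) ¬d

      value : ∀ k → answer 0 (em {P = ∃ (Determined G n k (prefix q k))}) ≡ 0 →
              answer 1 (em {P = ∃ (Determined G n k (prefix q k))}) ≡ s n
      value k eq with em {P = ∃ (Determined G n k (prefix q k))}
      ... | yes (v , det) = sym (det q s Gqs refl)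
      value k () | no _

  infixr 8 _^_

  _^_ : RepresentedSpace c₂ ℓ₂ r₂ → RepresentedSpace c₁ ℓ₁ r₁ →
        RepresentedSpace (lsuc 0ℓ ⊔ c₁ ⊔ ℓ₁ ⊔ r₁ ⊔ c₂ ⊔ ℓ₂ ⊔ r₂) (c₁ ⊔ ℓ₂) (c₁ ⊔ r₁ ⊔ r₂)
  Y ^ X = record
    { setoid       = record
      { Carrier       = Σ[ f ∈ Map X Y ] ContinuouslyRealisable X Y (Func.to f)
      ; _≈_           = λ (f , _) (g , _) → ∀ x → Y ∋ Func.to f x ≈ Func.to g x
      ; isEquivalence = record
        { refl  = λ _ → Y.refl
        ; sym   = λ h x → Y.sym (h x)
        ; trans = λ h k x → Y.trans (h x) (k x)
        }
      }
    ; _⊩_          = λ p (f , _) → Realises X Y (Coded p) (Func.to f)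
    ; ⊩-resp       = λ p≗q f≈g pf s x sx →
        let t , Cpst , tfx = pf s x sx
        in t , Coded-resp p≗q (λ _ → refl) Cpst , Y.⊩-resp (λ _ → refl) (f≈g x) tfx
    ; ⊩-functional = λ pf pg x →
        let s , sx         = X.⊩-surjective x
            t , Cpst , tfx = pf s x sx
            u , Cpsu , ugx = pg s x sx
        in Y.⊩-functional tfx
             (Y.⊩-resp (λ n → ⇓-deterministic (Cpsu n) (Cpst n)) Y.refl ugx)
    ; ⊩-surjective = λ (f , G , continuous , realises) →
        let p , coded = Continuous⇒Coded continuous
        in p , λ s x sx → let t , Gst , tfx = realises s x sx in t , coded Gst , tfx
    }
    where
    module X = RepresentedSpace X
    module Y where
      open RepresentedSpace Y public
      open Setoid (setoid Y) public using (refl; sym; trans)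

  𝒪 : RepresentedSpace c ℓ r → RepresentedSpace (lsuc 0ℓ ⊔ c ⊔ ℓ ⊔ r) c (c ⊔ r)
  𝒪 X = 𝕊 ^ X

  infix 4 _∈ᵒ_

  _∈ᵒ_ : {X : RepresentedSpace c ℓ r} → Carrier X → Carrier (𝒪 X) → Set
  x ∈ᵒ (χ , _) = Func.to χ x ≡ true

  ComputablyOpen : (X : RepresentedSpace c ℓ r) → Pred (Carrier X) a →
                   Set (lsuc 0ℓ ⊔ c ⊔ ℓ ⊔ r ⊔ a)
  ComputablyOpen X P =
    ∃[ U ] (ComputablePoint (𝒪 X) U × (∀ x → _∈ᵒ_ {X = X} x U ⇔ P x))

  ComputablyDiscrete : RepresentedSpace c ℓ r → Set (lsuc 0ℓ ⊔ c ⊔ ℓ ⊔ r)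
  ComputablyDiscrete X = ComputablyOpen (X ⊗ X) (λ (x , y) → X ∋ x ≈ y)

  ComputablyOvert : RepresentedSpace c ℓ r → Set (lsuc 0ℓ ⊔ c ⊔ ℓ ⊔ r)
  ComputablyOvert X = ComputablyOpen (𝒪 X) (λ U → ∃[ x ] _∈ᵒ_ {X = X} x U)

  neighbourhoods : (X : RepresentedSpace c ℓ r) → Carrier X → Carrier (𝒪 (𝒪 X))
  neighbourhoods X x =
    record { to = λ (χ , _) → Func.to χ x ; cong = λ U≈V → U≈V x } ,
    let q , qx = RepresentedSpace.⊩-surjective X x
    in (λ p s → Coded p q s) , Coded-continuous q , λ p U pU → pU q x qx

  -- The condition makes neighbourhoods injective: if neighbourhoods X x and
  -- neighbourhoods X y are equal, then they share a name p, and the q found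
  -- from p, being unique up to _≗_, is a name of both x and y.
  ComputablyAdmissible : RepresentedSpace c ℓ r → Set (c ⊔ ℓ ⊔ r ⊔ lsuc 0ℓ)
  ComputablyAdmissible X =
    ∃[ e ] (∀ p x → 𝒪 (𝒪 X) ∋ p ⊩ neighbourhoods X x → ∃[ q ] (Φ e p q × X ∋ q ⊩ x))

  record Ideal (_≪_ : Rel ℕ 0ℓ) : Set (lsuc 0ℓ) where
    field
      members    : Pred ℕ 0ℓ
      nonempty   : ∃[ x ] x ∈ members
      downClosed : ∀ {x y} → x ≪ y → y ∈ members → x ∈ members
      directed   : ∀ {x y} → x ∈ members → y ∈ members →
                   ∃[ z ] (z ∈ members × x ≪ z × y ≪ z)

  𝐈 : Rel ℕ 0ℓ → RepresentedSpace (lsuc 0ℓ) 0ℓ 0ℓ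
  𝐈 _≪_ = record
    { setoid       = record
      { Carrier       = Ideal _≪_
      ; _≈_           = λ I J → members I ≐ members J
      ; isEquivalence = record
        { refl  = (λ m → m) , (λ m → m)
        ; sym   = λ (f , g) → g , f
        ; trans = λ (f , g) (h , k) → (h ∘ f) , (g ∘ k)
        }
      }
    ; _⊩_          = λ p I → ∀ n → n ∈ members I ⇔ (∃[ k ] p k ≡ n)
    ; ⊩-resp       = λ p≗q (I⊆J , J⊆I) pI n → mk⇔
        (λ n∈J → map₂ (λ {k} eq → trans (sym (p≗q k)) eq) (Equivalence.to (pI n) (J⊆I n∈J)))
        (λ (k , eq) → I⊆J (Equivalence.from (pI n) (k , trans (p≗q k) eq)))
    ; ⊩-functional = λ pI pJ →
        (λ {n} → Equivalence.from (pJ n) ∘ Equivalence.to (pI n)) ,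
        (λ {n} → Equivalence.from (pI n) ∘ Equivalence.to (pJ n))
    ; ⊩-surjective = enumerate
    }
    where
    open Ideal
    enumerate : (I : Ideal _≪_) → ∃[ p ] (∀ n → n ∈ members I ⇔ (∃[ k ] p k ≡ n))
    enumerate I = p , λ n → mk⇔ (λ n∈I → n , hit n n∈I)
                                (λ (k , eq) → subst (members I) eq (sound k))
      where
      p : Baire
      p k with em {P = members I k}
      ... | yes _ = k
      ... | no  _ = proj₁ (nonempty I)

      hit : ∀ n → members I n → p n ≡ n
      hit n n∈I with em {P = members I n}
      ... | yes _   = refl
      ... | no  n∉I = contradiction n∈I n∉I

      sound : ∀ k → members I (p k)
      sound k with em {P = members I k}
      ... | yes k∈I = k∈I
      ... | no  _   = proj₂ (nonempty I)

  PrecomputablyQuasiPolish : RepresentedSpace c ℓ r → Set (lsuc 0ℓ ⊔ c ⊔ ℓ ⊔ r)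
  PrecomputablyQuasiPolish X =
    Σ[ _≪_ ∈ Rel ℕ 0ℓ ] (Transitive _≪_ × ComputablyEnumerable _≪_ × X ≅ 𝐈 _≪_)

  ComputablyQuasiPolish : RepresentedSpace c ℓ r → Set (lsuc 0ℓ ⊔ c ⊔ ℓ ⊔ r)
  ComputablyQuasiPolish X = PrecomputablyQuasiPolish X × ComputablyOvert X

{-# OPTIONS --safe #-}
module Submission where

-- The equivalences go through condition (3).
--
-- (2) ⇒ (3).  To semidecide m R n, run the realiser of admissibility on the
-- name of "both m and n are in U".  If m R n, this names the neighbourhoods of
-- the class of n, so the run halts.  If the run halts, it has read finitely much
-- of the name, which extends to names of the neighbourhoods of m and of n, so
-- that its output is equivalent to both.
--
-- (3) ⇒ (2).  The classes are uniformly open; given the neighbourhoods of x,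
-- search for a class among them.
--
-- (3) ⇒ (1).  Take R itself for ≪; its ideals are its classes.
--
-- (1) ⇒ (3).  If the equality test accepts a pair of equal sequences of lower
-- bounds of n, then two ideals that contain n have names that agree with these
-- sequences on the part read, so they are equal.  By discreteness every ideal
-- contains such an n, and by overtness the n that lie in some ideal can be
-- enumerated.  Two of them determine the same ideal iff they have a common
-- upper bound that lies in some ideal.

open import Defs
open import Axiom.ExcludedMiddle using (ExcludedMiddle)
open import Data.Bool.Base using (true; false)
open import Data.Fin.Base using (Fin; zero; suc)
open import Data.Fin.Patterns
open import Data.Nat.Base using (ℕ; zero; suc; pred; _+_; _*_; _∸_; _≤_; _<_; s≤s; s≤s⁻¹)
open import Data.Nat.Properties
open import Data.Product.Base using (_×_; Σ-syntax; ∃; ∃-syntax; _,_; proj₁; proj₂; map₂)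
open import Data.Sum.Base using (_⊎_; inj₁; inj₂)
open import Data.Vec.Base using (Vec; []; lookup) renaming (_∷_ to _∷ᵛ_)
open import Data.Vec.Relation.Binary.Pointwise.Inductive as Pointwise
  using (Pointwise; []) renaming (_∷_ to _∷ᵖ_)
open import Function.Base using (_∘_; _on_)
open import Function.Bundles using (Func; Inverse; Equivalence; _⇔_; mk⇔)
import Function.Construct.Composition as Composition
open import Level using (Level; 0ℓ) renaming (suc to lsuc)
open import Relation.Binary.Bundles using (Setoid)
import Relation.Binary.Construct.On as On
open import Relation.Binary.Core using (Rel; REL)
open import Relation.Binary.Definitions using (Transitive)
open import Relation.Binary.PropositionalEquality
  using (_≡_; _≢_; refl; sym; trans; cong; cong₂; subst; _≗_)
open import Relation.Binary.Structures using (IsEquivalence)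
open import Relation.Nullary.Decidable.Core using (yes; no)
open import Relation.Nullary.Negation.Core using (contradiction)
open import Relation.Unary using (Pred)

open RepresentedSpace using (setoid; Carrier)

-- Two features of the setting shape the programs. The relation `_⟦_⟧_⇓_` has no notion of time,
-- while the searches must dovetail over computations that may diverge; and a name of a function
-- carries its program as data, to be run when the name is read. A universal machine that works in
-- small steps serves both: `evaluation` is total and takes the number of steps as an argument, so
-- that each semidecision becomes a total function with a search for a nonzero value. When `m` and
-- `n` are unrelated, the name of "both are in U" names no point, and the realiser of admissibility
-- is unconstrained on it. The name therefore reserves room for flags, by which it can still turn
-- into the name of a point after any finite part has been read.

private
  variable
    k m n : ℕ

-- Total programs

-- A term with k function symbols and n variables denotes a total function;
-- the symbols are interpreted by codes that are total for the oracle at hand.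
data Term (k n : ℕ) : Set where
  var       : Fin n → Term k n
  lit       : ℕ → Term k n
  inc dec   : Term k n → Term k n
  ⟨_,_⟩     : Term k n → Term k n → Term k n
  fst snd   : Term k n → Term k n
  call      : Fin k → Term k n → Term k n
  ifZero    : Term k n → Term k n → Term k n → Term k n
  loop      : Term k n → Term k n → Term k (2 + n) → Term k n
  apply     : Term k m → Vec (Term k n) m → Term k n

π₁ π₂ : ℕ → ℕ
π₁ n = proj₁ (unpair n)
π₂ n = proj₂ (unpair n)

if0 : ℕ → ℕ → ℕ → ℕ
if0 zero    a b = a
if0 (suc _) a b = b

if0-≢0 : ∀ b {x y} → b ≢ 0 → if0 b x y ≡ y
if0-≢0 zero    b≢0 = contradiction refl b≢0
if0-≢0 (suc _) _   = refl

natrec : ℕ → ℕ → (ℕ → ℕ → ℕ) → ℕ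
natrec zero    a f = a
natrec (suc n) a f = f n (natrec n a f)

sem  : Vec (ℕ → ℕ) k → Term k n → Vec ℕ n → ℕ
sems : Vec (ℕ → ℕ) k → Vec (Term k n) m → Vec ℕ n → Vec ℕ m

sem gs (var i)        ρ = lookup ρ i
sem gs (lit n)        ρ = n
sem gs (inc t)        ρ = suc (sem gs t ρ)
sem gs (dec t)        ρ = pred (sem gs t ρ)
sem gs ⟨ s , t ⟩      ρ = ⟪ sem gs s ρ , sem gs t ρ ⟫
sem gs (fst t)        ρ = π₁ (sem gs t ρ)
sem gs (snd t)        ρ = π₂ (sem gs t ρ)
sem gs (call i t)     ρ = lookup gs i (sem gs t ρ)
sem gs (ifZero t a b) ρ = if0 (sem gs t ρ) (sem gs a ρ) (sem gs b ρ)
sem gs (loop t a b)   ρ = natrec (sem gs t ρ) (sem gs a ρ) (λ n y → sem gs b (y ∷ᵛ n ∷ᵛ ρ))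
sem gs (apply t ts)   ρ = sem gs t (sems gs ts ρ)

sems gs []        ρ = []
sems gs (t ∷ᵛ ts) ρ = sem gs t ρ ∷ᵛ sems gs ts ρ

constant : ℕ → Code
constant zero    = zero
constant (suc n) = comp succ (constant n)

project : Fin n → Code
project zero    = right
project (suc i) = comp (project i) left

compile    : Vec Code k → Term k n → Code
compileAll : Vec Code k → Vec (Term k n) m → Code

compile cs (var i)        = project i
compile cs (lit n)        = constant n
compile cs (inc t)        = comp succ (compile cs t)
compile cs (dec t)        = comp (prec zero (comp left right)) (pair zero (compile cs t))
compile cs ⟨ s , t ⟩      = pair (compile cs s) (compile cs t)
compile cs (fst t)        = comp left (compile cs t)
compile cs (snd t)        = comp right (compile cs t)
compile cs (call i t)     = comp (lookup cs i) (compile cs t)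
-- A recursion whose step ignores the counter and the previous value. It runs `a` in either case,
-- which is harmless since terms are total.
compile cs (ifZero t a b) =
  comp (prec (compile cs a) (comp (compile cs b) left)) (pair identity (compile cs t))
-- The step of `prec` sees ⟪ ρ , ⟪ n , y ⟫ ⟫, regrouped here as ⟪ ⟪ ρ , n ⟫ , y ⟫, the environment
-- in which `b` is compiled.
compile cs (loop t a b)   =
  comp (prec (compile cs a)
             (comp (compile cs b) (pair (pair left (comp left right)) (comp right right))))
       (pair identity (compile cs t))
compile cs (apply t ts)   = comp (compile cs t) (compileAll cs ts)

compileAll cs []        = zero
compileAll cs (t ∷ᵛ ts) = pair (compileAll cs ts) (compile cs t)

environment : Vec ℕ n → ℕ
environment []       = 0
environment (x ∷ᵛ ρ) = ⟪ environment ρ , x ⟫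

-- Opaque so that unification can recover cs and t from program cs t.
opaque
  program : Vec Code k → Term k 1 → Code
  program cs t = comp (compile cs t) (pair zero identity)

⇓constant : ∀ {α x} n → constant n ⟦ α ⟧ x ⇓ n
⇓constant zero    = ⇓zero
⇓constant (suc n) = ⇓comp (⇓constant n) ⇓succ

module _ {α : Baire} where

  ⇓project : ∀ (i : Fin n) ρ → project i ⟦ α ⟧ environment ρ ⇓ lookup ρ i
  ⇓project zero    (x ∷ᵛ ρ) = ⇓right′ (environment ρ) x
  ⇓project (suc i) (x ∷ᵛ ρ) = ⇓comp (⇓left′ (environment ρ) x) (⇓project i ρ)

  ⇓dec : ∀ n → prec zero (comp left right) ⟦ α ⟧ ⟪ 0 , n ⟫ ⇓ pred n
  ⇓dec zero    = ⇓prec-zero (unpair-pair 0 0) ⇓zero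
  ⇓dec (suc n) =
    ⇓prec-suc (unpair-pair 0 (suc n)) (⇓dec n) (⇓comp (⇓right′ 0 _) (⇓left′ n _))

  module _ {cs : Vec Code k} {gs : Vec (ℕ → ℕ) k}
           (total : Pointwise (λ c g → Φ c α g) cs gs) where

    ⇓compile    : ∀ (t : Term k n) ρ → compile cs t ⟦ α ⟧ environment ρ ⇓ sem gs t ρ
    ⇓compileAll : ∀ (ts : Vec (Term k n) m) ρ →
                  compileAll cs ts ⟦ α ⟧ environment ρ ⇓ environment (sems gs ts ρ)

    ⇓compile (var i)        ρ = ⇓project i ρ
    ⇓compile (lit n)        ρ = ⇓constant n
    ⇓compile (inc t)        ρ = ⇓comp (⇓compile t ρ) ⇓succ
    ⇓compile (dec t)        ρ = ⇓comp (⇓pair ⇓zero (⇓compile t ρ)) (⇓dec _)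
    ⇓compile ⟨ s , t ⟩      ρ = ⇓pair (⇓compile s ρ) (⇓compile t ρ)
    ⇓compile (fst t)        ρ = ⇓comp (⇓compile t ρ) ⇓left
    ⇓compile (snd t)        ρ = ⇓comp (⇓compile t ρ) ⇓right
    ⇓compile (call i t)     ρ = ⇓comp (⇓compile t ρ) (Pointwise.lookup total i _)
    ⇓compile (ifZero t a b) ρ = ⇓comp (⇓pair (⇓identity _) (⇓compile t ρ)) (branch (sem gs t ρ))
      where
      branch : ∀ n → prec (compile cs a) (comp (compile cs b) left) ⟦ α ⟧ ⟪ environment ρ , n ⟫
                     ⇓ if0 n (sem gs a ρ) (sem gs b ρ)
      branch zero    = ⇓prec-zero (unpair-pair _ 0) (⇓compile a ρ)
      branch (suc n) = ⇓prec-suc (unpair-pair _ (suc n)) (branch n)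
        (⇓comp (⇓left′ _ _) (⇓compile b ρ))
    ⇓compile (loop t a b)   ρ = ⇓comp (⇓pair (⇓identity _) (⇓compile t ρ)) (iterate (sem gs t ρ))
      where
      iterate : ∀ n → prec (compile cs a) (comp (compile cs b)
                        (pair (pair left (comp left right)) (comp right right)))
                        ⟦ α ⟧ ⟪ environment ρ , n ⟫
                      ⇓ natrec n (sem gs a ρ) (λ m y → sem gs b (y ∷ᵛ m ∷ᵛ ρ))
      iterate zero    = ⇓prec-zero (unpair-pair _ 0) (⇓compile a ρ)
      iterate (suc n) = ⇓prec-suc (unpair-pair _ (suc n)) (iterate n)
        (⇓comp (⇓pair (⇓pair (⇓left′ _ _) (⇓comp (⇓right′ _ _) (⇓left′ n _)))
                      (⇓comp (⇓right′ _ _) (⇓right′ n _)))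
               (⇓compile b (_ ∷ᵛ n ∷ᵛ ρ)))
    ⇓compile (apply t ts)   ρ = ⇓comp (⇓compileAll ts ρ) (⇓compile t (sems gs ts ρ))

    ⇓compileAll []        ρ = ⇓zero
    ⇓compileAll (t ∷ᵛ ts) ρ = ⇓pair (⇓compileAll ts ρ) (⇓compile t ρ)

    opaque
      unfolding program

      Φ-program : ∀ {t} → Φ (program cs t) α (λ x → sem gs t (x ∷ᵛ []))
      Φ-program {t} x = ⇓comp (⇓pair ⇓zero (⇓identity x)) (⇓compile t (x ∷ᵛ []))

-- A universal program

-- A state ⟪ v , K ⟫ of the abstract machine has a value v and a stack K of
-- frames; a non-empty stack is the successor of a pair, and a frame is a
-- pair of a tag and an argument.
run-frame pair-frame : ℕ → ℕ
run-frame  e = ⟪ 0 , e ⟫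
pair-frame y = ⟪ 1 , y ⟫

-- Waits for the first component of a pair; `v` is the saved input for the second program `d`.
then-frame : ℕ → ℕ → ℕ
then-frame d v = ⟪ 2 , ⟪ d , v ⟫ ⟫

-- Waits for the value of `c` at ⟪ v , n ⟫: zero ends the search with `n`, any other value moves it
-- on to `suc n`.
find-frame : ℕ → ℕ → ℕ → ℕ
find-frame c v n = ⟪ 3 , ⟪ c , ⟪ v , n ⟫ ⟫ ⟫

infixr 5 _▹_

_▹_ : ℕ → ℕ → ℕ
f ▹ K = suc ⟪ f , K ⟫

private
  infixr 5 _▹ᵗ_

  _▹ᵗ_ : Term k n → Term k n → Term k n
  f ▹ᵗ K = inc ⟨ f , K ⟩

  run-term pair-term : Term k n → Term k n
  run-term  e = ⟨ lit 0 , e ⟩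
  pair-term y = ⟨ lit 1 , y ⟩

  then-term : Term k n → Term k n → Term k n
  then-term d v = ⟨ lit 2 , ⟨ d , v ⟩ ⟩

  find-term : Term k n → Term k n → Term k n → Term k n
  find-term c v n = ⟨ lit 3 , ⟨ c , ⟨ v , n ⟩ ⟩ ⟩

switch : Term k n → Vec (Term k n) m → Term k n → Term k n
switch t []        d = d
switch t (b ∷ᵛ bs) d = ifZero t b (switch (dec t) bs d)

-- The function symbol answers the oracle queries, with z as a parameter.
run-step frame-step : Term 1 5
run-step = switch tag
  (⟨ lit 0 , K ⟩ ∷ᵛ
   ⟨ inc v , K ⟩ ∷ᵛ
   ⟨ fst v , K ⟩ ∷ᵛ
   ⟨ snd v , K ⟩ ∷ᵛ
   ⟨ call 0F ⟨ z , v ⟩ , K ⟩ ∷ᵛ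
   ⟨ v , run-term (fst a) ▹ᵗ then-term (snd a) v ▹ᵗ K ⟩ ∷ᵛ
   ⟨ v , run-term (snd a) ▹ᵗ run-term (fst a) ▹ᵗ K ⟩ ∷ᵛ
   ifZero (snd v)
     ⟨ fst v , run-term (fst a) ▹ᵗ K ⟩
     -- The recursive call runs first; the two pair frames then put the counter and the parameter in
     -- front of its value, which is the input that the step program expects.
     ⟨ ⟨ fst v , dec (snd v) ⟩ ,
       run-term ⟨ lit 7 , a ⟩ ▹ᵗ pair-term (dec (snd v)) ▹ᵗ pair-term (fst v) ▹ᵗ
         run-term (snd a) ▹ᵗ K ⟩ ∷ᵛ
   [])
  ⟨ ⟨ v , lit 0 ⟩ , run-term a ▹ᵗ find-term a v (lit 0) ▹ᵗ K ⟩
  where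
  tag = var 0F
  a   = var 1F
  K   = var 2F
  v   = var 3F
  z   = var 4F
frame-step = switch tag
  (apply run-step (fst a ∷ᵛ snd a ∷ᵛ K ∷ᵛ v ∷ᵛ z ∷ᵛ []) ∷ᵛ
   ⟨ ⟨ a , v ⟩ , K ⟩ ∷ᵛ
   ⟨ snd a , run-term (fst a) ▹ᵗ pair-term v ▹ᵗ K ⟩ ∷ᵛ
   [])
  (ifZero v
    ⟨ i , K ⟩
    ⟨ ⟨ x , inc i ⟩ , run-term (fst a) ▹ᵗ find-term (fst a) x (inc i) ▹ᵗ K ⟩)
  where
  tag = var 0F
  a   = var 1F
  K   = var 2F
  v   = var 3F
  z   = var 4F
  x   = fst (snd a)
  i   = snd (snd a)

-- A state with empty stack is a fixed point, so running longer than necessary does not change the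
-- result.
step : Term 1 2
step = ifZero (snd σ) σ
  (apply frame-step
    (fst (fst κ) ∷ᵛ snd (fst κ) ∷ᵛ snd κ ∷ᵛ fst σ ∷ᵛ var 1F ∷ᵛ []))
  where
  σ = var 0F
  κ = dec (snd σ)

-- The graph of `decode`, free of fuel, so that proofs can recurse on an index and its code
-- together. A code has many indices: payloads of atomic codes are ignored, and every tag from 8 on
-- means `rfind`.
data Index : ℕ → Code → Set where
  zero   : ∀ {k} → Index ⟪ 0 , k ⟫ zero
  succ   : ∀ {k} → Index ⟪ 1 , k ⟫ succ
  left   : ∀ {k} → Index ⟪ 2 , k ⟫ left
  right  : ∀ {k} → Index ⟪ 3 , k ⟫ right
  oracle : ∀ {k} → Index ⟪ 4 , k ⟫ oracle
  pair   : ∀ {a b c d} → Index a c → Index b d → Index ⟪ 5 , ⟪ a , b ⟫ ⟫ (pair c d)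
  comp   : ∀ {a b c d} → Index a c → Index b d → Index ⟪ 6 , ⟪ a , b ⟫ ⟫ (comp c d)
  prec   : ∀ {a b c d} → Index a c → Index b d → Index ⟪ 7 , ⟪ a , b ⟫ ⟫ (prec c d)
  rfind  : ∀ {t a c} → Index a c → Index ⟪ 8 + t , a ⟫ (rfind c)

decodeWith-Index : ∀ f n → n < f → Index n (decodeWith f n)
decodeWith-Index (suc f) n (s≤s n≤f) =
  subst (λ m → Index m (decodeTag f (unpair n))) (pair-unpair n)
    (tagged (π₁ n) (π₂ n) (subst (_≤ f) (sym (pair-unpair n)) n≤f))
  where
  component : ∀ t k → ⟪ suc t , k ⟫ ≤ f →
              Index (π₁ k) (decodeWith f (π₁ k)) × Index (π₂ k) (decodeWith f (π₂ k))
  component t k le =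
    decodeWith-Index f (π₁ k) (fuelˡ t (π₁ k) (π₂ k) le′) ,
    decodeWith-Index f (π₂ k) (fuelʳ t (π₁ k) (π₂ k) le′)
    where
    le′ = subst (λ j → ⟪ suc t , j ⟫ ≤ f) (sym (pair-unpair k)) le

  resp : ∀ {t k c} → Index ⟪ t , ⟪ π₁ k , π₂ k ⟫ ⟫ c → Index ⟪ t , k ⟫ c
  resp {t} {k} {c} = subst (λ j → Index ⟪ t , j ⟫ c) (pair-unpair k)

  tagged : ∀ t k → ⟪ t , k ⟫ ≤ f → Index ⟪ t , k ⟫ (decodeTag f (t , k))
  tagged 0 k le = zero
  tagged 1 k le = succ
  tagged 2 k le = left
  tagged 3 k le = right
  tagged 4 k le = oracle
  tagged 5 k le = let i , j = component 4 k le in resp (pair i j)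
  tagged 6 k le = let i , j = component 5 k le in resp (comp i j)
  tagged 7 k le = let i , j = component 6 k le in resp (prec i j)
  tagged (suc (suc (suc (suc (suc (suc (suc (suc t)))))))) k le =
    rfind (decodeWith-Index f k (≤-trans (b<pair _ k) le))

decode-Index : ∀ n → Index n (decode n)
decode-Index n = decodeWith-Index (suc n) n ≤-refl

module Machine (f : ℕ → ℕ) (z : ℕ) where

  next-state : ℕ → ℕ
  next-state σ = sem (f ∷ᵛ []) step (σ ∷ᵛ z ∷ᵛ [])

  frame : ℕ → ℕ → ℕ → ℕ → ℕ
  frame t a K v = sem (f ∷ᵛ []) frame-step (t ∷ᵛ a ∷ᵛ K ∷ᵛ v ∷ᵛ z ∷ᵛ [])

  run : ℕ → ℕ → ℕ → ℕ → ℕ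
  run t a K v = sem (f ∷ᵛ []) run-step (t ∷ᵛ a ∷ᵛ K ∷ᵛ v ∷ᵛ z ∷ᵛ [])

  next-halted : ∀ y → next-state ⟪ y , 0 ⟫ ≡ ⟪ y , 0 ⟫
  next-halted y rewrite unpair-pair y 0 = refl

  next-frame : ∀ t a K v → next-state ⟪ v , ⟪ t , a ⟫ ▹ K ⟫ ≡ frame t a K v
  next-frame t a K v
    rewrite unpair-pair v (⟪ t , a ⟫ ▹ K) | unpair-pair ⟪ t , a ⟫ K | unpair-pair t a = refl

  next-run : ∀ t a K v → next-state ⟪ v , run-frame ⟪ t , a ⟫ ▹ K ⟫ ≡ run t a K v
  next-run t a K v = trans (next-frame 0 ⟪ t , a ⟫ K v)
    (cong (λ p → run (proj₁ p) (proj₂ p) K v) (unpair-pair t a))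

  next-pair-frame : ∀ y K v → next-state ⟪ v , pair-frame y ▹ K ⟫ ≡ ⟪ ⟪ y , v ⟫ , K ⟫
  next-pair-frame y K v = next-frame 1 y K v

  next-then-frame : ∀ d x K v → next-state ⟪ v , then-frame d x ▹ K ⟫ ≡
                                ⟪ x , run-frame d ▹ pair-frame v ▹ K ⟫
  next-then-frame d x K v = trans (next-frame 2 ⟪ d , x ⟫ K v)
    (cong (λ p → ⟪ proj₂ p , run-frame (proj₁ p) ▹ pair-frame v ▹ K ⟫) (unpair-pair d x))

  next-find-zero : ∀ c x n K → next-state ⟪ 0 , find-frame c x n ▹ K ⟫ ≡ ⟪ n , K ⟫
  next-find-zero c x n K = trans (next-frame 3 ⟪ c , ⟪ x , n ⟫ ⟫ K 0) lemma
    where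
    lemma : frame 3 ⟪ c , ⟪ x , n ⟫ ⟫ K 0 ≡ ⟪ n , K ⟫
    lemma rewrite unpair-pair c ⟪ x , n ⟫ | unpair-pair x n = refl

  next-find-suc : ∀ c x n K v → next-state ⟪ suc v , find-frame c x n ▹ K ⟫ ≡
                  ⟪ ⟪ x , suc n ⟫ , run-frame c ▹ find-frame c x (suc n) ▹ K ⟫
  next-find-suc c x n K v = trans (next-frame 3 ⟪ c , ⟪ x , n ⟫ ⟫ K (suc v)) lemma
    where
    lemma : frame 3 ⟪ c , ⟪ x , n ⟫ ⟫ K (suc v) ≡
            ⟪ ⟪ x , suc n ⟫ , run-frame c ▹ find-frame c x (suc n) ▹ K ⟫
    lemma rewrite unpair-pair c ⟪ x , n ⟫ | unpair-pair x n = refl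

  next-pair : ∀ c d K v → next-state ⟪ v , run-frame ⟪ 5 , ⟪ c , d ⟫ ⟫ ▹ K ⟫ ≡
              ⟪ v , run-frame c ▹ then-frame d v ▹ K ⟫
  next-pair c d K v = trans (next-run 5 ⟪ c , d ⟫ K v)
    (cong (λ p → ⟪ v , run-frame (proj₁ p) ▹ then-frame (proj₂ p) v ▹ K ⟫) (unpair-pair c d))

  next-comp : ∀ c d K v → next-state ⟪ v , run-frame ⟪ 6 , ⟪ c , d ⟫ ⟫ ▹ K ⟫ ≡
              ⟪ v , run-frame d ▹ run-frame c ▹ K ⟫
  next-comp c d K v = trans (next-run 6 ⟪ c , d ⟫ K v)
    (cong (λ p → ⟪ v , run-frame (proj₂ p) ▹ run-frame (proj₁ p) ▹ K ⟫) (unpair-pair c d))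

  next-prec-zero : ∀ c d K {v a} → unpair v ≡ (a , zero) →
                   next-state ⟪ v , run-frame ⟪ 7 , ⟪ c , d ⟫ ⟫ ▹ K ⟫ ≡ ⟪ a , run-frame c ▹ K ⟫
  next-prec-zero c d K {v} {a} eq = trans (next-run 7 ⟪ c , d ⟫ K v) lemma
    where
    lemma : run 7 ⟪ c , d ⟫ K v ≡ ⟪ a , run-frame c ▹ K ⟫
    lemma rewrite eq | unpair-pair c d = refl

  next-prec-suc : ∀ c d K {v a n} → unpair v ≡ (a , suc n) →
                  next-state ⟪ v , run-frame ⟪ 7 , ⟪ c , d ⟫ ⟫ ▹ K ⟫ ≡
                  ⟪ ⟪ a , n ⟫ , run-frame ⟪ 7 , ⟪ c , d ⟫ ⟫ ▹ pair-frame n ▹ pair-frame a ▹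
                                run-frame d ▹ K ⟫
  next-prec-suc c d K {v} {a} {n} eq = trans (next-run 7 ⟪ c , d ⟫ K v) lemma
    where
    lemma : run 7 ⟪ c , d ⟫ K v ≡
            ⟪ ⟪ a , n ⟫ , run-frame ⟪ 7 , ⟪ c , d ⟫ ⟫ ▹ pair-frame n ▹ pair-frame a ▹
                          run-frame d ▹ K ⟫
    lemma rewrite eq | unpair-pair c d = refl

  steps : ℕ → ℕ → ℕ
  steps zero    σ = σ
  steps (suc s) σ = steps s (next-state σ)

  steps-+ : ∀ s t σ → steps (s + t) σ ≡ steps t (steps s σ)
  steps-+ zero    t σ = refl
  steps-+ (suc s) t σ = steps-+ s t (next-state σ)

  infix 4 _⟶*_

  _⟶*_ : ℕ → ℕ → Set
  σ ⟶* τ = ∃[ s ] steps s σ ≡ τ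

  infixr 2 _then_

  _then_ : ∀ {ρ σ τ} → next-state ρ ≡ σ → σ ⟶* τ → ρ ⟶* τ
  refl then (s , eq) = suc s , eq

  infixr 2 _⟫_

  _⟫_ : ∀ {ρ σ τ} → ρ ⟶* σ → σ ⟶* τ → ρ ⟶* τ
  _⟫_ {ρ} (s , refl) (t , refl) = s + t , steps-+ s t ρ

  done : ∀ {σ} → σ ⟶* σ
  done = 0 , refl

  β : Baire
  β i = f ⟪ z , i ⟫

  -- An arbitrary stack `K` is allowed so that the runs of the components can be chained, each one
  -- returning to the frames left for the next.
  complete : ∀ {e c x y} → Index e c → c ⟦ β ⟧ x ⇓ y → ∀ K →
             ⟪ x , run-frame e ▹ K ⟫ ⟶* ⟪ y , K ⟫
  -- Induction on the distance `k` from the current candidate `n` to the least zero `N`.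
  searches : ∀ {e c x N} (v : ℕ → ℕ) k n → k + n ≡ N → Index e c →
             (∀ m → m < N → c ⟦ β ⟧ ⟪ x , m ⟫ ⇓ suc (v m)) → c ⟦ β ⟧ ⟪ x , N ⟫ ⇓ 0 → ∀ K →
             ⟪ ⟪ x , n ⟫ , run-frame e ▹ find-frame e x n ▹ K ⟫ ⟶* ⟪ N , K ⟫

  complete (zero {k})       ⇓zero   K = next-run 0 k K _ then done
  complete (succ {k})       ⇓succ   K = next-run 1 k K _ then done
  complete (left {k})       ⇓left   K = next-run 2 k K _ then done
  complete (right {k})      ⇓right  K = next-run 3 k K _ then done
  complete (oracle {k})     ⇓oracle K = next-run 4 k K _ then done
  complete (pair {a} {b} i j) (⇓pair {x = x} {y = y} {z = w} p q) K =
    next-pair a b K x then complete i p _ ⟫ next-then-frame b x K y then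
    complete j q _ ⟫ next-pair-frame y K w then done
  complete (comp {a} {b} i j) (⇓comp p q) K =
    next-comp a b K _ then complete j p _ ⟫ complete i q K
  complete (prec {a} {b} i j) (⇓prec-zero eq p) K =
    next-prec-zero a b K eq then complete i p K
  complete (prec {a} {b} i j) (⇓prec-suc eq p q) K =
    next-prec-suc a b K eq then complete (prec i j) p _ ⟫ next-pair-frame _ _ _ then
    next-pair-frame _ _ _ then complete j q K
  complete (rfind {t} {a} i) (⇓rfind {n = n} v p q) K =
    next-run (8 + t) a K _ then searches v n 0 (+-identityʳ n) i p q K

  searches v zero    n refl i p q K = complete i q _ ⟫ next-find-zero _ _ n K then done
  searches {x = x} v (suc k) n refl i p q K =
    complete i (p n (s≤s (m≤n+m n k))) _ ⟫ next-find-suc _ x n K (v n) then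
    searches v k (suc n) (+-suc k n) i p q K

  module _ {y₀ : ℕ} where

    -- A non-empty stack is a successor, so the state has not halted and a step remains. The strict
    -- decrease feeds the induction in `sound`.
    advance : ∀ s {v h K τ} → next-state ⟪ v , h ▹ K ⟫ ≡ τ →
              steps s ⟪ v , h ▹ K ⟫ ≡ ⟪ y₀ , 0 ⟫ → ∃[ t ] (t < s × steps t τ ≡ ⟪ y₀ , 0 ⟫)
    advance zero    _    eq = contradiction (cong proj₂ (pair-injective eq)) λ ()
    advance (suc s) refl eq = s , ≤-refl , eq

    Returns : ℕ → Code → ℕ → ℕ → Set
    Returns s c x K =
      ∃[ y ] ∃[ t ] (t < s × c ⟦ β ⟧ x ⇓ y × steps t ⟪ y , K ⟫ ≡ ⟪ y₀ , 0 ⟫)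

    -- Strong induction on the number of steps, with `b` as its bound. Recursion on the code would
    -- not do, because `prec` runs itself again and `rfind` runs its body repeatedly.
    sound : ∀ b {s} → s < b → ∀ {e c x K} → Index e c →
            steps s ⟪ x , run-frame e ▹ K ⟫ ≡ ⟪ y₀ , 0 ⟫ → Returns s c x K
    finds : ∀ b {s} → s < b → ∀ {e c x K} n → Index e c →
            (∀ m → m < n → ∃[ w ] c ⟦ β ⟧ ⟪ x , m ⟫ ⇓ suc w) →
            steps s ⟪ ⟪ x , n ⟫ , run-frame e ▹ find-frame e x n ▹ K ⟫ ≡ ⟪ y₀ , 0 ⟫ →
            Returns s (rfind c) x K

    sound (suc b) {s} s<b (zero {k}) h =
      let t , t<s , h₁ = advance s (next-run 0 k _ _) h in _ , t , t<s , ⇓zero , h₁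
    sound (suc b) {s} s<b (succ {k}) h =
      let t , t<s , h₁ = advance s (next-run 1 k _ _) h in _ , t , t<s , ⇓succ , h₁
    sound (suc b) {s} s<b (left {k}) h =
      let t , t<s , h₁ = advance s (next-run 2 k _ _) h in _ , t , t<s , ⇓left , h₁
    sound (suc b) {s} s<b (right {k}) h =
      let t , t<s , h₁ = advance s (next-run 3 k _ _) h in _ , t , t<s , ⇓right , h₁
    sound (suc b) {s} s<b (oracle {k}) h =
      let t , t<s , h₁ = advance s (next-run 4 k _ _) h in _ , t , t<s , ⇓oracle , h₁
    sound (suc b) {s} (s≤s s≤b) (pair i j) h =
      let t₁ , l₁ , h₁     = advance s (next-pair _ _ _ _) h
          b₁               = <-≤-trans l₁ s≤b
          y , t₂ , l₂ , p , h₂ = sound b b₁ i h₁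
          t₃ , l₃ , h₃     = advance t₂ (next-then-frame _ _ _ _) h₂
          l₃₁              = <-trans l₃ l₂
          w , t₄ , l₄ , q , h₄ = sound b (<-trans l₃₁ b₁) j h₃
          t₅ , l₅ , h₅     = advance t₄ (next-pair-frame _ _ _) h₄
      in _ , t₅ , <-trans l₅ (<-trans l₄ (<-trans l₃₁ l₁)) , ⇓pair p q , h₅
    sound (suc b) {s} (s≤s s≤b) (comp i j) h =
      let t₁ , l₁ , h₁     = advance s (next-comp _ _ _ _) h
          b₁               = <-≤-trans l₁ s≤b
          y , t₂ , l₂ , p , h₂ = sound b b₁ j h₁
          w , t₃ , l₃ , q , h₃ = sound b (<-trans l₂ b₁) i h₂
      in w , t₃ , <-trans l₃ (<-trans l₂ l₁) , ⇓comp p q , h₃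
    sound (suc b) {s} (s≤s s≤b) {x = x} (prec i j) h with unpair x in eq
    ... | a , zero =
      let t₁ , l₁ , h₁     = advance s (next-prec-zero _ _ _ eq) h
          y , t₂ , l₂ , p , h₂ = sound b (<-≤-trans l₁ s≤b) i h₁
      in y , t₂ , <-trans l₂ l₁ , ⇓prec-zero eq p , h₂
    ... | a , suc n =
      let t₁ , l₁ , h₁     = advance s (next-prec-suc _ _ _ eq) h
          b₁               = <-≤-trans l₁ s≤b
          y , t₂ , l₂ , p , h₂ = sound b b₁ (prec i j) h₁
          t₃ , l₃ , h₃     = advance t₂ (next-pair-frame _ _ _) h₂
          t₄ , l₄ , h₄     = advance t₃ (next-pair-frame _ _ _) h₃
          l₄₁              = <-trans l₄ (<-trans l₃ l₂)
          w , t₅ , l₅ , q , h₅ = sound b (<-trans l₄₁ b₁) j h₄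
      in w , t₅ , <-trans l₅ (<-trans l₄₁ l₁) , ⇓prec-suc eq p q , h₅
    sound (suc b) {s} (s≤s s≤b) (rfind {t} {a} i) h =
      let t₁ , l₁ , h₁ = advance s (next-run (8 + t) a _ _) h
          y , t₂ , l₂ , p , h₂ = finds b (<-≤-trans l₁ s≤b) 0 i (λ _ ()) h₁
      in y , t₂ , <-trans l₂ l₁ , p , h₂

    finds (suc b) {s} s<b {c = c} {x} n i below h
      with sound (suc b) s<b i h
    ... | zero , t₁ , l₁ , p , h₁ =
      let t₂ , l₂ , h₂ = advance t₁ (next-find-zero _ _ n _) h₁
      in n , t₂ , <-trans l₂ l₁ , ⇓rfind value defined p , h₂
      where
      value : ℕ → ℕ
      value m with m <? n
      ... | yes m<n = proj₁ (below m m<n)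
      -- `⇓rfind` asks for a function on all numbers, but constrains it only below `n`.
      ... | no  _   = 0

      defined : ∀ m → m < n → c ⟦ β ⟧ ⟪ x , m ⟫ ⇓ suc (value m)
      defined m m<n with m <? n
      ... | yes m<n′ = proj₂ (below m m<n′)
      ... | no  m≮n  = contradiction m<n m≮n
    ... | suc w , t₁ , l₁ , p , h₁ =
      let t₂ , l₂ , h₂ = advance t₁ (next-find-suc _ _ n _ w) h₁
          l₂₀ = <-trans l₂ l₁
          y , t₃ , l₃ , q , h₃ = finds b (<-≤-trans l₂₀ (s≤s⁻¹ s<b)) (suc n) i below′ h₂
      in y , t₃ , <-trans l₃ l₂₀ , q , h₃
      where
      below′ : ∀ m → m < suc n → ∃[ w ] c ⟦ β ⟧ ⟪ x , m ⟫ ⇓ suc w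
      below′ m m<1+n with m≤n⇒m<n∨m≡n (s≤s⁻¹ m<1+n)
      ... | inj₁ m<n  = below m m<n
      ... | inj₂ refl = w , p

  steps-next : ∀ s σ → steps s (next-state σ) ≡ next-state (steps s σ)
  steps-next zero    σ = refl
  steps-next (suc s) σ = steps-next s (next-state σ)

  iterate-steps : ∀ s σ → natrec s σ (λ _ → next-state) ≡ steps s σ
  iterate-steps zero    σ = refl
  iterate-steps (suc s) σ = trans (cong next-state (iterate-steps s σ)) (sym (steps-next s σ))

-- The value on ⟪ ⟪ z , ⟪ e , x ⟫ ⟫ , s ⟫ is suc y if program e with parameter z
-- and input x halts with output y within s steps, and 0 if it does not halt.
evaluation-term : Term 1 1
evaluation-term = ifZero (snd final) (inc (fst final)) (lit 0)
  where
  e = fst (snd (fst (var 0F)))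
  x = snd (snd (fst (var 0F)))
  final = loop (snd (var 0F)) ⟨ x , run-term e ▹ᵗ lit 0 ⟩
    (apply step (var 0F ∷ᵛ fst (fst (var 2F)) ∷ᵛ []))

opaque
  evaluation : (ℕ → ℕ) → ℕ → ℕ
  evaluation f x = sem (f ∷ᵛ []) evaluation-term (x ∷ᵛ [])

  evaluator : Code → Code
  evaluator o = program (o ∷ᵛ []) evaluation-term

  Φ-evaluator : ∀ {o α f} → Φ o α f → Φ (evaluator o) α (evaluation f)
  Φ-evaluator total = Φ-program (total ∷ᵖ [])

module _ (f : ℕ → ℕ) (z e x : ℕ) where
  open Machine f z

  private
    final : ℕ → ℕ
    final s = steps s ⟪ x , run-frame e ▹ 0 ⟫

  opaque
    unfolding evaluation

    evaluation-final : ∀ s → evaluation f ⟪ ⟪ z , ⟪ e , x ⟫ ⟫ , s ⟫ ≡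
                             if0 (π₂ (final s)) (suc (π₁ (final s))) 0
    evaluation-final s
      rewrite unpair-pair ⟪ z , ⟪ e , x ⟫ ⟫ s | unpair-pair z ⟪ e , x ⟫ | unpair-pair e x
            | iterate-steps s ⟪ x , run-frame e ▹ 0 ⟫ = refl

  evaluation-complete : ∀ {y} → decode e ⟦ β ⟧ x ⇓ y →
                        ∃[ s ] evaluation f ⟪ ⟪ z , ⟪ e , x ⟫ ⟫ , s ⟫ ≡ suc y
  evaluation-complete {y} h with complete (decode-Index e) h 0
  ... | s , eq = s , trans (evaluation-final s) halted
    where
    halted : if0 (π₂ (final s)) (suc (π₁ (final s))) 0 ≡ suc y
    halted rewrite eq | unpair-pair y 0 = refl

  evaluation-sound : ∀ {y} s → evaluation f ⟪ ⟪ z , ⟪ e , x ⟫ ⟫ , s ⟫ ≡ suc y →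
                     decode e ⟦ β ⟧ x ⇓ y
  evaluation-sound {y} s eq =
    let w , t , _ , p , h = sound (suc s) ≤-refl (decode-Index e) halted
    -- Once the program has returned to the empty stack, the remaining `t` steps change nothing, so
    -- its value `w` is the `y` read off at the end.
    in ⇓-cast (cong proj₁ (pair-injective (trans (sym (absorbing t)) h))) p
    where
    invert : ∀ b {a} → if0 b (suc a) 0 ≡ suc y → b ≡ 0 × a ≡ y
    invert zero refl = refl , refl

    halted : final s ≡ ⟪ y , 0 ⟫
    halted with invert (π₂ (final s)) (trans (sym (evaluation-final s)) eq)
    ... | stack , value = trans (sym (pair-unpair (final s))) (cong₂ ⟪_,_⟫ value stack)

    absorbing : ∀ {v} t → steps t ⟪ v , 0 ⟫ ≡ ⟪ v , 0 ⟫
    absorbing zero        = refl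
    absorbing {v} (suc t) = trans (cong (steps t) (next-halted v)) (absorbing t)

-- Search, simulation and composition of programs

uncurry : (ℕ → ℕ → ℕ) → ℕ → ℕ
uncurry f w = f (π₁ w) (π₂ w)

uncurry-pair : ∀ f a b → uncurry f ⟪ a , b ⟫ ≡ f a b
uncurry-pair f a b = cong (λ (x , y) → f x y) (unpair-pair a b)

uncurry₄ : (ℕ → ℕ → ℕ → ℕ → ℕ) → ℕ → ℕ
uncurry₄ f w = f (π₁ w) (π₁ (π₁ (π₂ w))) (π₂ (π₁ (π₂ w))) (π₂ (π₂ w))

uncurry₄-pair : ∀ f a b c d → uncurry₄ f ⟪ a , ⟪ ⟪ b , c ⟫ , d ⟫ ⟫ ≡ f a b c d
uncurry₄-pair f a b c d
  rewrite unpair-pair a ⟪ ⟪ b , c ⟫ , d ⟫ | unpair-pair ⟪ b , c ⟫ d | unpair-pair b c = refl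

⇓-resp : ∀ {e p q x y} → p ≗ q → e ⟦ p ⟧ x ⇓ y → e ⟦ q ⟧ x ⇓ y
⇓-resp p≗q h = proj₂ (⇓-finite-use h) (Agree-prefix p≗q)

module _ (f : ℕ → Baire) (z : ℕ) (c : Code) {x y : ℕ} where

  evaluation-encode-complete : c ⟦ f z ⟧ x ⇓ y →
    ∃[ s ] evaluation (uncurry f) ⟪ ⟪ z , ⟪ encode c , x ⟫ ⟫ , s ⟫ ≡ suc y
  evaluation-encode-complete h = evaluation-complete (uncurry f) z (encode c) x
    (subst (λ d → d ⟦ _ ⟧ x ⇓ y) (sym (decode-encode c))
      (⇓-resp (λ i → sym (uncurry-pair f z i)) h))

  evaluation-encode-sound : ∀ s →
    evaluation (uncurry f) ⟪ ⟪ z , ⟪ encode c , x ⟫ ⟫ , s ⟫ ≡ suc y → c ⟦ f z ⟧ x ⇓ y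
  evaluation-encode-sound s eq = ⇓-resp (uncurry-pair f z)
    (subst (λ d → d ⟦ _ ⟧ x ⇓ y) (decode-encode c)
      (evaluation-sound (uncurry f) z (encode c) x s eq))

-- Acceptance is signalled by a nonzero value while `rfind` looks for a zero, hence the swap.
firstHit : Code → Code
firstHit c = rfind (program (c ∷ᵛ []) (ifZero (call 0F (var 0F)) (lit 1) (lit 0)))

module _ {c α g} (total : Φ c α g) where

  private
    missed : ℕ → ℕ
    missed n = if0 (g n) 1 0

    hit⇒ : ∀ {a} → a ≢ 0 → if0 a 1 0 ≡ 0
    hit⇒ {zero}  a≢0 = contradiction refl a≢0
    hit⇒ {suc a} _   = refl

    ⇒hit : ∀ {a} → if0 a 1 0 ≡ 0 → a ≢ 0
    ⇒hit {suc a} _ ()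

    Φ-missed : Φ (program (c ∷ᵛ []) (ifZero (call 0F (var 0F)) (lit 1) (lit 0))) α missed
    Φ-missed = Φ-program (total ∷ᵖ [])

  ⇓firstHit : ∀ {x m} → g ⟪ x , m ⟫ ≢ 0 → ∃[ n ] (firstHit c ⟦ α ⟧ x ⇓ n × g ⟪ x , n ⟫ ≢ 0)
  ⇓firstHit {x} {m} hit with least (λ n → missed ⟪ x , n ⟫) m (hit⇒ hit)
  ... | n , eq , below =
    n , ⇓rfind (λ i → pred (missed ⟪ x , i ⟫))
          (λ i i<n → ⇓-cast (below i i<n) (Φ-missed ⟪ x , i ⟫))
          (⇓-cast eq (Φ-missed ⟪ x , n ⟫)) , ⇒hit eq

  firstHit⇓ : ∀ {x n} → firstHit c ⟦ α ⟧ x ⇓ n → g ⟪ x , n ⟫ ≢ 0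
  firstHit⇓ {x} {n} (⇓rfind _ _ h) = ⇒hit (⇓-deterministic (Φ-missed ⟪ x , n ⟫) h)

≢0⇒suc : ∀ {n} → n ≢ 0 → ∃[ m ] n ≡ suc m
≢0⇒suc {zero}  n≢0 = contradiction refl n≢0
≢0⇒suc {suc m} _   = m , refl

suc⇒≢0 : ∀ {n m} → n ≡ suc m → n ≢ 0
suc⇒≢0 refl ()

-- Searches for a sufficient number of steps and evaluates again with it; `dec` removes the
-- successor that marks halting.
simulate : Code → Code
simulate o = comp (program (evaluator o ∷ᵛ []) (dec (call 0F (var 0F))))
                  (pair identity (firstHit (evaluator o)))

⇓simulate : ∀ {o α f z e x y} → Φ o α f → decode e ⟦ (λ i → f ⟪ z , i ⟫) ⟧ x ⇓ y →
            simulate o ⟦ α ⟧ ⟪ z , ⟪ e , x ⟫ ⟫ ⇓ y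
⇓simulate {f = f} {z} {e} {x} total h =
  let s , eq           = evaluation-complete f z e x h
      s′ , found , hit = ⇓firstHit (Φ-evaluator total) {m = s} (suc⇒≢0 eq)
      w , eq′          = ≢0⇒suc hit
      value            = trans (cong pred eq′) (⇓-deterministic (evaluation-sound f z e x s′ eq′) h)
  in ⇓comp (⇓pair (⇓identity _) found)
       (⇓-cast value (Φ-program (Φ-evaluator total ∷ᵖ []) _))

-- On ⟪ z , x ⟫, run the program with the index that idx computes from z, with
-- input x and the oracle that o computes with parameter z.
runAt : Code → Code → Code
runAt idx o = comp (simulate o)
  (program (idx ∷ᵛ []) ⟨ fst (var 0F) , ⟨ call 0F (fst (var 0F)) , snd (var 0F) ⟩ ⟩)

Φ-runAt : ∀ {idx o α k f g} → Φ idx α k → Φ o α (uncurry f) →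
          (∀ z → Φ (decode (k z)) (f z) (g z)) → Φ (runAt idx o) α (uncurry g)
Φ-runAt {k = k} {f} Φidx Φo halts w =
  ⇓comp (Φ-program (Φidx ∷ᵖ []) w)
        (⇓simulate Φo (Φ-resp (decode (k z)) (λ i → sym (uncurry-pair f z i)) (halts z) (π₂ w)))
  where z = π₁ w

runWith : Code → Code → Code
runWith c = runAt (constant (encode c))

Φ-runWith : ∀ {c o α f g} → Φ o α (uncurry f) → (∀ z → Φ c (f z) (g z)) →
            Φ (runWith c o) α (uncurry g)
Φ-runWith {c} {f = f} {g} Φo halts =
  Φ-runAt (λ _ → ⇓constant (encode c)) Φo
    (λ z → subst (λ d → Φ d (f z) (g z)) (sym (decode-encode c)) (halts z))

at0 : Code → Code
at0 c = comp c (pair zero identity)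

Φ-at0 : ∀ {c α g} → Φ c α (uncurry g) → Φ (at0 c) α (g 0)
Φ-at0 {g = g} total i =
  ⇓-cast (uncurry-pair g 0 i) (⇓comp (⇓pair ⇓zero (⇓identity i)) (total ⟪ 0 , i ⟫))

infixr 9 _∘ᶜ_

-- Composition of operators on Baire space, unlike `comp`: the output sequence of `c` is the oracle
-- of `d`, so `d` has to be simulated.
_∘ᶜ_ : Code → Code → Code
d ∘ᶜ c = at0 (runWith d (comp c right))

Φ-∘ᶜ : ∀ {c d p q s} → Φ c p q → Φ d q s → Φ (d ∘ᶜ c) p s
Φ-∘ᶜ {q = q} {s} Φc Φd = Φ-at0 {g = λ _ → s}
  (Φ-runWith {f = λ _ → q} (λ w → ⇓comp ⇓right (Φc (π₂ w))) (λ _ → Φd))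

-- Makes a program for the trivial oracle usable as a subroutine under any other oracle.
relativise : Code → Code
relativise c = c ∘ᶜ zero

Φ-relativise : ∀ {c α q} → Φ c 0ω q → Φ (relativise c) α q
Φ-relativise = Φ-∘ᶜ (λ _ → ⇓zero)

parity-term half-term : Term k 1
parity-term = loop (var 0F) (lit 0) (ifZero (var 0F) (lit 1) (lit 0))
half-term   = loop (var 0F) (lit 0)
  (ifZero (apply parity-term (var 1F ∷ᵛ [])) (var 0F) (inc (var 0F)))

parity half : ℕ → ℕ
parity n = sem [] parity-term (n ∷ᵛ [])
half   n = sem [] half-term (n ∷ᵛ [])

interleave-half : ∀ p q n → interleave p q n ≡ if0 (parity n) (p (half n)) (q (half n))
interleave-half p q zero    = refl
interleave-half p q (suc n) = trans (interleave-half q (tail p) n) (swap (parity n))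
  where
  swap : ∀ b {h} → if0 b (q h) (p (suc h)) ≡
                   if0 (if0 b 1 0) (p (if0 b h (suc h))) (q (if0 b h (suc h)))
  swap zero    = refl
  swap (suc _) = refl

interleave-diagonal : ∀ p n → interleave p p n ≡ p (half n)
interleave-diagonal p n = trans (interleave-half p p n) (same (parity n))
  where
  same : ∀ b {a} → if0 b a a ≡ a
  same zero    = refl
  same (suc _) = refl

-- Names of points, functions and open sets

-- Evaluates the function named by the sequence of `q` at a family of arguments. The index is the
-- head of that name and thus known only at run time; its tail, interleaved with the argument, is
-- the oracle.
applyName : Code → Code → Code
applyName q r = runAt (comp q zero) (program (q ∷ᵛ r ∷ᵛ [])
  (ifZero (apply parity-term (i ∷ᵛ []))
    (call 0F (inc (apply half-term (i ∷ᵛ []))))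
    (call 1F ⟨ fst (var 0F) , apply half-term (i ∷ᵛ []) ⟩)))
  where i = snd (var 0F)

Φ-applyName : ∀ {q r α Q ρ g} → Φ q α Q → Φ r α (uncurry ρ) →
              (∀ z → Coded Q (ρ z) (g z)) → Φ (applyName q r) α (uncurry g)
Φ-applyName {α = α} {Q} {ρ} Φq Φr coded =
  Φ-runAt {f = λ z → interleave (tail Q) (ρ z)} (λ z → ⇓comp ⇓zero (Φq 0))
    (λ w → ⇓-cast (value w) (Φ-program (Φq ∷ᵖ Φr ∷ᵖ []) w)) coded
  where
  value : ∀ w → if0 (parity (π₂ w)) (Q (suc (half (π₂ w))))
                    (uncurry ρ ⟪ π₁ w , half (π₂ w) ⟫) ≡
                interleave (tail Q) (ρ (π₁ w)) (π₂ w)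
  value w = trans
    (cong (if0 (parity (π₂ w)) (Q (suc (half (π₂ w))))) (uncurry-pair ρ (π₁ w) (half (π₂ w))))
    (sym (interleave-half (tail Q) (ρ (π₁ w)) (π₂ w)))

ComputableSequence⇒Φ : ∀ {p} → ComputableSequence p →
                       ∃[ c ] (∀ {r s} → Coded p r s → Φ c r s)
ComputableSequence⇒Φ {p} (c , Φp) =
  at0 (applyName (relativise c) (comp oracle right)) , λ {r} {s} coded →
    Φ-at0 {g = λ _ → s}
      (Φ-applyName {ρ = λ _ → r} (Φ-relativise Φp) (λ w → ⇓comp ⇓right ⇓oracle) (λ _ → coded))

evenPart oddPart : Code
evenPart = comp oracle double
oddPart  = readArgument

Φ-evenPart : ∀ r → Φ evenPart r (λ n → r (2 * n))
Φ-evenPart r n = ⇓comp (⇓double n) ⇓oracle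

Φ-oddPart : ∀ r → Φ oddPart r (λ n → r (suc (2 * n)))
Φ-oddPart r n = ⇓comp (⇓comp (⇓double n) ⇓succ) ⇓oracle

Φ-nameTail : ∀ α q → Φ evenPart (interleave α q) α
Φ-nameTail α q n = ⇓-cast (interleave-even α q n) (Φ-evenPart (interleave α q) n)

-- A coded machine sees its argument at the odd positions only, so `c` is composed with their
-- extraction. The tail of the name carries no information.
Φ⇒ComputableSequence : ∀ c → ∃[ p ] (ComputableSequence p × (∀ {r s} → Φ c r s → Coded p r s))
Φ⇒ComputableSequence c =
    p , (program [] t , λ n → ⇓-cast (value n) (Φ-program [] n)) ,
  λ {r} Φs → Φ⇒Coded d 0ω (Φ-∘ᶜ (⇓readArgument 0ω r) Φs)
  where
  d = c ∘ᶜ readArgument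
  p = encode d ∷ 0ω
  t : Term 0 1
  t = ifZero (var 0F) (lit (encode d)) (lit 0)

  value : ∀ n → if0 n (encode d) 0 ≡ p n
  value zero    = refl
  value (suc n) = refl

pointName : Code
pointName = program [] (ifZero (snd (var 0F)) (fst (var 0F)) (lit 0))

Φ-pointName : ∀ {α} → Φ pointName α (uncurry (λ n → n ∷ 0ω))
Φ-pointName w = ⇓-cast (value (π₁ w) (π₂ w)) (Φ-program [] w)
  where
  value : ∀ n i → if0 i n 0 ≡ (n ∷ 0ω) i
  value n zero    = refl
  value n (suc i) = refl

-- The index `e` is fixed and the parameter sits in the tail of the name; this takes the place of
-- the s-m-n theorem.
parameterNames : ℕ → Code
parameterNames e = program [] (ifZero (snd (var 0F)) (lit e) (fst (var 0F)))

Φ-parameterNames : ∀ {e α} → Φ (parameterNames e) α (uncurry (λ m → e ∷ λ _ → m))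
Φ-parameterNames {e} w = ⇓-cast (value (π₁ w) (π₂ w)) (Φ-program [] w)
  where
  value : ∀ m i → if0 i e m ≡ (e ∷ λ _ → m) i
  value m zero    = refl
  value m (suc i) = refl

interleaveCode : Code → Code → Code
interleaveCode c d = program (c ∷ᵛ d ∷ᵛ [])
  (ifZero (apply parity-term (var 0F ∷ᵛ []))
    (call 0F (apply half-term (var 0F ∷ᵛ [])))
    (call 1F (apply half-term (var 0F ∷ᵛ []))))

Φ-interleaveCode : ∀ {c d α p q} → Φ c α p → Φ d α q →
                   Φ (interleaveCode c d) α (interleave p q)
Φ-interleaveCode {p = p} {q} Φp Φq n =
  ⇓-cast (sym (interleave-half p q n)) (Φ-program (Φp ∷ᵖ Φq ∷ᵖ []) n)

conj : ℕ → ℕ → ℕ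
conj a b = if0 a 0 b

conj⇒ : ∀ {a b} → conj a b ≢ 0 → a ≢ 0 × b ≢ 0
conj⇒ {zero}  h = contradiction refl h
conj⇒ {suc a} h = (λ ()) , h

⇒conj : ∀ {a b} → a ≢ 0 → b ≢ 0 → conj a b ≢ 0
⇒conj {zero}  ha hb = contradiction refl ha
⇒conj {suc a} ha hb = hb

monus-term equal-term : Term k 2
monus-term = loop (var 1F) (var 0F) (dec (var 0F))
equal-term = ifZero (apply monus-term (var 0F ∷ᵛ var 1F ∷ᵛ []))
  (ifZero (apply monus-term (var 1F ∷ᵛ var 0F ∷ᵛ [])) (lit 1) (lit 0)) (lit 0)

equal : ℕ → ℕ → ℕ
equal m n = sem [] equal-term (m ∷ᵛ n ∷ᵛ [])

monus-∸ : ∀ m n → sem [] monus-term (m ∷ᵛ n ∷ᵛ []) ≡ m ∸ n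
monus-∸ m zero    = refl
monus-∸ m (suc n) = trans (cong pred (monus-∸ m n)) (pred[m∸n]≡m∸[1+n] m n)

equal-∸ : ∀ m n → equal m n ≡ if0 (m ∸ n) (if0 (n ∸ m) 1 0) 0
equal-∸ m n = cong₂ (λ a b → if0 a (if0 b 1 0) 0) (monus-∸ m n) (monus-∸ n m)

equal-refl : ∀ n → equal n n ≢ 0
equal-refl n = suc⇒≢0 (trans (equal-∸ n n) (cong (λ a → if0 a (if0 a 1 0) 0) (n∸n≡0 n)))

equal⇒≡ : ∀ m n → equal m n ≢ 0 → m ≡ n
equal⇒≡ m n h with m ∸ n in eq₁ | n ∸ m in eq₂ | subst (_≢ 0) (equal-∸ m n) h
... | zero  | zero  | _ = ≤-antisym (m∸n≡0⇒m≤n eq₁) (m∸n≡0⇒m≤n eq₂)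
... | zero  | suc _ | h′ = contradiction refl h′
... | suc _ | _     | h′ = contradiction refl h′

Hits : Baire → Set
Hits s = ∃[ j ] s j ≢ 0

⊩𝕊-intro : ∀ {s} b → (b ≡ true → Hits s) → (Hits s → b ≡ true) → s ⊩𝕊 b
⊩𝕊-intro     true  hits _    s≗0 = let j , sj≢0 = hits refl in sj≢0 (s≗0 j)
⊩𝕊-intro {s} false _    miss n with s n in eq
... | zero  = refl
... | suc _ with () ← miss (n , suc⇒≢0 eq)

⊩𝕊-hit : ∀ {s b} → s ⊩𝕊 b → Hits s → b ≡ true
⊩𝕊-hit {b = true}  _   _        = refl
⊩𝕊-hit {b = false} s≗0 (j , sj) = contradiction (s≗0 j) sj

private
  variable
    a c ℓ r c₁ ℓ₁ r₁ c₂ ℓ₂ r₂ c₃ ℓ₃ r₃ : Level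

Coded-continuousʳ : ∀ p → Continuous (Coded p)
Coded-continuousʳ p coded n with Φ-continuous (decode (p 0)) coded n
... | m , use = m , λ coded′ h → use coded′ (Agree-interleave m (λ _ _ → refl) h)

Computable-∘ : (X : RepresentedSpace c₁ ℓ₁ r₁) (Y : RepresentedSpace c₂ ℓ₂ r₂)
               (Z : RepresentedSpace c₃ ℓ₃ r₃) → ∀ {f g} →
               Computable Y Z g → Computable X Y f → Computable X Z (g ∘ f)
Computable-∘ X Y Z (d , Φd) (e , Φe) = d ∘ᶜ e , λ p x px →
  let q , Φpq , qy = Φe p x px
      s , Φqs , sz = Φd q _ qy
  in s , Φ-∘ᶜ Φpq Φqs , sz

≅-trans : {X : RepresentedSpace c₁ ℓ₁ r₁} {Y : RepresentedSpace c₂ ℓ₂ r₂}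
          {Z : RepresentedSpace c₃ ℓ₃ r₃} → X ≅ Y → Y ≅ Z → X ≅ Z
≅-trans {X = X} {Y} {Z} f g = record
  { inverse        = Composition.inverse (_≅_.inverse f) (_≅_.inverse g)
  ; to-computable   = Computable-∘ X Y Z (_≅_.to-computable g) (_≅_.to-computable f)
  ; from-computable = Computable-∘ Z Y X (_≅_.from-computable f) (_≅_.from-computable g)
  }

-- Semidecidable relations

record Semidecider (R : Rel ℕ a) : Set a where
  field
    code     : Code
    fun      : ℕ → ℕ
    -- Every oracle is allowed, so that the code can be called inside any program.
    total    : ∀ {α} → Φ code α fun
    complete : ∀ {m n} → R m n → ∃[ t ] fun ⟪ ⟪ m , n ⟫ , t ⟫ ≢ 0
    sound    : ∀ {m n} t → fun ⟪ ⟪ m , n ⟫ , t ⟫ ≢ 0 → R m n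

ComputablyEnumerable⇒Semidecider : {R : Rel ℕ a} → ComputablyEnumerable R → Semidecider R
ComputablyEnumerable⇒Semidecider (c , enumerates) = record
  { code     = program (evaluator zero ∷ᵛ []) t
  ; fun      = fun
  ; total    = Φ-program (Φ-evaluator (λ _ → ⇓zero) ∷ᵖ [])
  ; complete = λ {m} {n} Rmn →
      let v , h  = Equivalence.to (enumerates m n) Rmn
          s , eq = evaluation-encode-complete (λ _ → 0ω) 0 c h
      in s , suc⇒≢0 (trans (fun-pair ⟪ m , n ⟫ s) eq)
  ; sound    = λ {m} {n} s hit →
      let v , eq = ≢0⇒suc hit
      in Equivalence.from (enumerates m n)
           (v , evaluation-encode-sound (λ _ → 0ω) 0 c s
             (trans (sym (fun-pair ⟪ m , n ⟫ s)) eq))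
  }
  where
  t : Term 1 1
  t = call 0F ⟨ ⟨ lit 0 , ⟨ lit (encode c) , fst (var 0F) ⟩ ⟩ , snd (var 0F) ⟩

  fun : ℕ → ℕ
  fun w = evaluation 0ω ⟪ ⟪ 0 , ⟪ encode c , π₁ w ⟫ ⟫ , π₂ w ⟫

  fun-pair : ∀ x s → fun ⟪ x , s ⟫ ≡ evaluation 0ω ⟪ ⟪ 0 , ⟪ encode c , x ⟫ ⟫ , s ⟫
  fun-pair = uncurry-pair (λ x s → evaluation 0ω ⟪ ⟪ 0 , ⟪ encode c , x ⟫ ⟫ , s ⟫)

Semidecider⇒ComputablyEnumerable : {R : Rel ℕ a} → Semidecider R → ComputablyEnumerable R
Semidecider⇒ComputablyEnumerable S = firstHit code , λ m n → mk⇔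
  (λ Rmn → let t , hit = complete Rmn ; v , h , _ = ⇓firstHit total hit in v , h)
  (λ (v , h) → sound v (firstHit⇓ {g = fun} total h))
  where open Semidecider S

module Listing {R : Rel ℕ a} (S : Semidecider R) where
  open Semidecider S

  -- The default `d` fills the entries at which nothing has been accepted; it belongs to the listed
  -- set as soon as `R d d` holds.
  listed : ℕ → ℕ → ℕ → ℕ
  listed d m t = if0 (fun ⟪ ⟪ m , d ⟫ , t ⟫) d m

  listing : ℕ → Baire
  listing d = uncurry (listed d)

  listingCode : Code → Code
  listingCode c = program (c ∷ᵛ code ∷ᵛ [])
    (ifZero (call 1F ⟨ ⟨ fst (var 0F) , start ⟩ , snd (var 0F) ⟩) start (fst (var 0F)))
    where start = call 0F (lit 0)

  Φ-listing : ∀ {c α q} → Φ c α q → Φ (listingCode c) α (listing (q 0))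
  Φ-listing Φq = Φ-program (Φq ∷ᵖ total ∷ᵖ [])

  listing-members : ∀ {d m} → R d d → R m d ⇔ (∃[ k ] listing d k ≡ m)
  listing-members {d} {m} Rdd = mk⇔
    (λ Rmd → let t , hit = complete Rmd
             in ⟪ m , t ⟫ , trans (uncurry-pair (listed d) m t) (if0-≢0 (fun ⟪ ⟪ m , d ⟫ , t ⟫) hit))
    (λ { (w , refl) → member (π₁ w) (π₂ w) })
    where
    member : ∀ m t → R (listed d m t) d
    member m t with fun ⟪ ⟪ m , d ⟫ , t ⟫ in eq
    ... | zero  = Rdd
    ... | suc _ = sound t (suc⇒≢0 eq)

-- Open sets as accepting programs

module Classical (em : ∀ {a} → ExcludedMiddle a) where

  truth : (P : Set a) → ∃[ b ] (b ≡ true ⇔ P)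
  truth P with em {P = P}
  ... | yes p = true , mk⇔ (λ _ → p) (λ _ → refl)
  ... | no ¬p = false , mk⇔ (λ ()) (λ p → contradiction p ¬p)

  -- A name of ⊤ is only known to differ from `0ω`; excluded middle yields a position where it does.
  ⊩𝕊-true : ∀ {s b} → s ⊩𝕊 b → b ≡ true → Hits s
  ⊩𝕊-true {s} s⊩⊤ refl with em {P = Hits s}
  ... | yes hits = hits
  ... | no ¬hits = contradiction (⊩𝕊-intro false (λ ()) (λ h → contradiction h ¬hits)) s⊩⊤

  Accepts : (X : RepresentedSpace c ℓ r) → REL Baire Baire 0ℓ → Pred (Carrier X) a → Set _
  Accepts X G P = ∀ p x → X ∋ p ⊩ x → ∃[ s ] (G p s × (Hits s ⇔ P x))

  module _ (X : RepresentedSpace c ℓ r) {P : Pred (Carrier X) a}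
           (P-resp : ∀ {x y} → X ∋ x ≈ y → P x → P y) where

    private
      characteristic : Map X 𝕊
      characteristic = record
        { to   = λ x → proj₁ (truth (P x))
        ; cong = λ {x} {y} x≈y →
            same (proj₂ (truth (P x))) (proj₂ (truth (P y))) (P-resp x≈y) (P-resp (X.sym x≈y))
        }
        where
        module X = Setoid (setoid X)

        same : ∀ {b b′ x y} → (b ≡ true ⇔ P x) → (b′ ≡ true ⇔ P y) →
               (P x → P y) → (P y → P x) → b ≡ b′
        same {true}  {true}  _ _ _ _ = refl
        same {false} {false} _ _ _ _ = refl
        same {true}  {false} h k f _ = sym (Equivalence.from k (f (Equivalence.to h refl)))
        same {false} {true}  h k _ g = Equivalence.from h (g (Equivalence.to k refl))

      realises : ∀ {G} → Accepts X G P → Realises X 𝕊 G (Func.to characteristic)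
      realises accepts p x px =
        let s , Gps , hits = accepts p x px
            b⇔P            = proj₂ (truth (P x))
        in s , Gps , ⊩𝕊-intro _ (λ b → Equivalence.from hits (Equivalence.to b⇔P b))
                               (λ h → Equivalence.from b⇔P (Equivalence.to hits h))

    openSet : ∀ {p} → Accepts X (Coded p) P →
              ∃[ U ] (𝒪 em X ∋ p ⊩ U × (∀ x → _∈ᵒ_ em {X = X} x U ⇔ P x))
    openSet {p} accepts =
      (characteristic , Coded p , Coded-continuousʳ p , realises accepts) ,
      realises accepts , λ x → proj₂ (truth (P x))

    Accepts⇒ComputablyOpen : ∀ c → Accepts X (Φ c) P → ComputablyOpen em X P
    Accepts⇒ComputablyOpen c accepts =
      let p , computable , coded = Φ⇒ComputableSequence c
          U , pU , U⇔P = openSet {p} (λ q x qx →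
            let s , Φqs , hits = accepts q x qx in s , coded Φqs , hits)
      in U , (p , computable , pU) , U⇔P

  ComputablyOpen⇒Accepts : (X : RepresentedSpace c ℓ r) {P : Pred (Carrier X) a} →
                           ComputablyOpen em X P → ∃[ c ] Accepts X (Φ c) P
  ComputablyOpen⇒Accepts X (U , (p , computable , pU) , U⇔P) =
    let c , Φc = ComputableSequence⇒Φ computable
    in c , λ q x qx →
      let s , coded , s⊩ = pU q x qx
      in s , Φc coded , mk⇔ (λ h → Equivalence.to (U⇔P x) (⊩𝕊-hit s⊩ h))
                           (λ Px → ⊩𝕊-true s⊩ (Equivalence.from (U⇔P x) Px))

  -- From an admissible quotient to a ceer

  module AdmissibleQuotient {R : Rel ℕ 0ℓ} (isEq : IsEquivalence R)
                            (admissible : ComputablyAdmissible em (ℕ/ R isEq)) where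

    private
      module R = IsEquivalence isEq
      Y = ℕ/ R isEq

    -- In a name machine ∷ T, the entry T (2 + i) is a flag.  As long as it is 0
    -- the machine waits for an open set to contain both T 0 and T 1; once a
    -- flag suc b is seen, it waits for the set to contain T b.
    machine : Code
    machine = program (evenPart ∷ᵛ applyName readArgument pointName ∷ᵛ [])
      (ifZero flag
        (ifZero (call 1F ⟨ call 0F (lit 0) , i ⟩) (lit 0) (call 1F ⟨ call 0F (lit 1) , j ⟩))
        (call 1F ⟨ call 0F (dec flag) , j ⟩))
      where
      i    = fst (var 0F)
      j    = snd (var 0F)
      flag = call 0F (inc (inc i))

    -- The first two hypotheses prevent wrong acceptance: a flag points into the class of `x`, and
    -- waiting for both entries includes waiting for a member of that class. The last one guarantees
    -- acceptance when `x` is in the set.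
    neighbourhoods-name : ∀ T x → (∀ {i b} → T (2 + i) ≡ suc b → R (T b) x) →
                          R (T 0) x ⊎ R (T 1) x →
                          R (T 0) x × R (T 1) x ⊎ ∃[ i ] T (2 + i) ≢ 0 →
                          𝒪 em (𝒪 em Y) ∋ encode machine ∷ T ⊩ neighbourhoods em Y x
    neighbourhoods-name T x flagged either enough q U@(χ , _) qU =
      s , Φ⇒Coded machine T Φs , ⊩𝕊-intro (Func.to χ x) complete sound
      where
      u : ℕ → Baire
      u n = proj₁ (qU (n ∷ 0ω) n R.refl)

      u⊩ : ∀ n → u n ⊩𝕊 Func.to χ n
      u⊩ n = proj₂ (proj₂ (qU (n ∷ 0ω) n R.refl))

      -- The index `i` serves twice, as the position of a flag and as the time at which the
      -- membership of `T 0` is accepted.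
      output : ℕ → ℕ → ℕ
      output i j = if0 (T (2 + i))
        (if0 (uncurry u ⟪ T 0 , i ⟫) 0 (uncurry u ⟪ T 1 , j ⟫))
        (uncurry u ⟪ T (pred (T (2 + i))) , j ⟫)

      s : Baire
      s = uncurry output

      Φs : Φ machine (interleave T q) s
      Φs = Φ-program (Φ-nameTail T q ∷ᵖ Φ-applyName (⇓readArgument T q) Φ-pointName
                       (λ n → proj₁ (proj₂ (qU (n ∷ 0ω) n R.refl))) ∷ᵖ [])

      move : ∀ {m n} → R m n → Func.to χ m ≡ true → Func.to χ n ≡ true
      move Rmn eq = trans (sym (Func.cong χ Rmn)) eq

      hit : ∀ n {j} → uncurry u ⟪ n , j ⟫ ≢ 0 → Func.to χ n ≡ true
      hit n {j} h = ⊩𝕊-hit (u⊩ n) (j , subst (_≢ 0) (uncurry-pair u n j) h)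

      hit⁻¹ : ∀ n → Func.to χ n ≡ true → ∃[ j ] uncurry u ⟪ n , j ⟫ ≢ 0
      hit⁻¹ n eq = map₂ (λ {j} → subst (_≢ 0) (sym (uncurry-pair u n j))) (⊩𝕊-true (u⊩ n) eq)

      output-flag : ∀ i j {b} → T (2 + i) ≡ suc b → output i j ≡ uncurry u ⟪ T b , j ⟫
      output-flag i j eq rewrite eq = refl

      output-wait : ∀ i j → T (2 + i) ≡ 0 →
                    output i j ≡ if0 (uncurry u ⟪ T 0 , i ⟫) 0 (uncurry u ⟪ T 1 , j ⟫)
      output-wait i j eq rewrite eq = refl

      sound : Hits s → Func.to χ x ≡ true
      sound (w , h) with T (2 + π₁ w) in eq
      ... | suc b = move (flagged eq) (hit (T b) h)
      ... | zero  = select either (conj⇒ {uncurry u ⟪ T 0 , π₁ w ⟫} h)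
        where
        select : R (T 0) x ⊎ R (T 1) x →
                 uncurry u ⟪ T 0 , π₁ w ⟫ ≢ 0 × uncurry u ⟪ T 1 , π₂ w ⟫ ≢ 0 → Func.to χ x ≡ true
        select (inj₁ R₀) (h₀ , _) = move R₀ (hit (T 0) h₀)
        select (inj₂ R₁) (_ , h₁) = move R₁ (hit (T 1) h₁)

      output⇒hits : ∀ i j → output i j ≢ 0 → Hits s
      output⇒hits i j h = ⟪ i , j ⟫ , subst (_≢ 0) (sym (uncurry-pair output i j)) h

      at-flag : Func.to χ x ≡ true → ∀ i b → T (2 + i) ≡ suc b → Hits s
      at-flag x∈U i b eq =
        let j , h = hit⁻¹ (T b) (move (R.sym (flagged eq)) x∈U)
        in output⇒hits i j (subst (_≢ 0) (sym (output-flag i j eq)) h)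

      complete : Func.to χ x ≡ true → Hits s
      complete x∈U = cases enough
        where
        wait : R (T 1) x → ∀ i → uncurry u ⟪ T 0 , i ⟫ ≢ 0 → Hits s
        wait R₁ i h₀ with T (2 + i) in eq
        -- The position at which `T 0` is accepted may itself carry a flag, and then the flag
        -- decides.
        ... | suc b = at-flag x∈U i b eq
        ... | zero  =
          let j , h₁ = hit⁻¹ (T 1) (move (R.sym R₁) x∈U)
          in output⇒hits i j (subst (_≢ 0) (sym (output-wait i j eq)) (⇒conj h₀ h₁))

        cases : R (T 0) x × R (T 1) x ⊎ ∃[ i ] T (2 + i) ≢ 0 → Hits s
        cases (inj₂ (i , h))   = let b , eq = ≢0⇒suc h in at-flag x∈U i b eq
        cases (inj₁ (R₀ , R₁)) = let i , h₀ = hit⁻¹ (T 0) (move (R.sym R₀) x∈U) in wait R₁ i h₀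

    private
      e : Code
      e = proj₁ admissible

      name : ℕ → ℕ → Baire → Baire
      name m n flags = encode machine ∷ m ∷ n ∷ flags

      after : ℕ → ℕ → Baire
      after l b i with i <? l
      ... | yes _ = 0
      ... | no  _ = suc b

      after-suc : ∀ l b i {v} → after l b i ≡ suc v → v ≡ b
      after-suc l b i eq with i <? l
      after-suc l b i ()   | yes _
      after-suc l b i refl | no  _ = refl

      after-≥ : ∀ l b → after l b l ≢ 0
      after-≥ l b with l <? l
      ... | yes l<l = contradiction l<l (<-irrefl refl)
      ... | no  _   = λ ()

      agree : ∀ l b m n → Agree l (name m n 0ω) (name m n (after l b))
      agree l b m n zero                i<l = refl
      agree l b m n (suc zero)          i<l = refl
      agree l b m n (suc (suc zero))    i<l = refl
      agree l b m n (suc (suc (suc i))) i<l with i <? l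
      ... | yes _  = refl
      -- Flag `i` is entry 3 + i of the name, so the flags raised from `l` on lie beyond the first
      -- `l` entries.
      ... | no i≮l = contradiction (≤-trans (s≤s (m≤n+m i 3)) i<l) i≮l

      T : ℕ → ℕ → Baire → Baire
      T m n flags = m ∷ n ∷ flags

      -- A computation on the unflagged name depends on finitely many flags, so
      -- it is also a computation on names of the neighbourhoods of m and of n.
      flagged-output : ∀ {m n v} b x → (∀ flags → T m n flags b ≡ x) → R m x ⊎ R n x →
                       e ⟦ name m n 0ω ⟧ 0 ⇓ v → R v x
      flagged-output {m} {n} b x Tb≡x either h =
        let l , use      = ⇓-finite-use h
            flags        = after l b
            q , Φq , Rqx = proj₂ admissible (name m n flags) x
              (neighbourhoods-name (T m n flags) x
                (λ {i} eq → R.reflexive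
                  (trans (cong (T m n flags) (after-suc l b i eq)) (Tb≡x flags)))
                either (inj₂ (l , after-≥ l b)))
        in subst (λ w → R w x) (⇓-deterministic (Φq 0) (use (agree l b m n))) Rqx

      oracles : Code
      oracles = program [] (ifZero i (lit (encode machine))
        (ifZero (dec i) (fst z) (ifZero (dec (dec i)) (snd z) (lit 0))))
        where
        z = fst (var 0F)
        i = snd (var 0F)

      oracle-of : ℕ → Baire
      oracle-of z = name (π₁ z) (π₂ z) 0ω

      Φ-oracles : ∀ {α} → Φ oracles α (uncurry oracle-of)
      Φ-oracles w = ⇓-cast (value (π₁ w) (π₂ w)) (Φ-program [] w)
        where
        value : ∀ z i → if0 i (encode machine) (if0 (pred i) (π₁ z) (if0 (pred (pred i)) (π₂ z) 0)) ≡
                        oracle-of z i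
        value z zero                = refl
        value z (suc zero)          = refl
        value z (suc (suc zero))    = refl
        value z (suc (suc (suc i))) = refl

      fun : ℕ → ℕ → ℕ
      fun z t = evaluation (uncurry oracle-of) ⟪ ⟪ z , ⟪ encode e , 0 ⟫ ⟫ , t ⟫

    semidecider : Semidecider R
    semidecider = record
      { code     = program (evaluator oracles ∷ᵛ [])
          (call 0F ⟨ ⟨ fst (var 0F) , ⟨ lit (encode e) , lit 0 ⟩ ⟩ , snd (var 0F) ⟩)
      ; fun      = uncurry fun
      ; total    = Φ-program (Φ-evaluator Φ-oracles ∷ᵖ [])
      ; complete = λ {m} {n} Rmn →
          let q , Φq , _ = proj₂ admissible (name m n 0ω) n
                (neighbourhoods-name (T m n 0ω) n (λ ()) (inj₁ Rmn) (inj₁ (Rmn , R.refl)))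
              t , eq = evaluation-encode-complete oracle-of ⟪ m , n ⟫ e
                (⇓-resp (λ i → sym (oracle-pair m n i)) (Φq 0))
          in t , suc⇒≢0 (trans (uncurry-pair fun ⟪ m , n ⟫ t) eq)
      ; sound    = λ {m} {n} t hit →
          let v , eq = ≢0⇒suc hit
              h = ⇓-resp (oracle-pair m n) (evaluation-encode-sound oracle-of ⟪ m , n ⟫ e t
                    (trans (sym (uncurry-pair fun ⟪ m , n ⟫ t)) eq))
          -- The same run is continued in two ways, with flags pointing to entry 0, which is `m`,
          -- and to entry 1, which is `n`; its output `v` is related to both.
          in R.trans (R.sym (flagged-output 0 m (λ _ → refl) (inj₁ R.refl) h))
                     (flagged-output 1 n (λ _ → refl) (inj₂ R.refl) h)
      }
      where
      oracle-pair : ∀ m n i → oracle-of ⟪ m , n ⟫ i ≡ name m n 0ω i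
      oracle-pair m n i = cong (λ (a , b) → name a b 0ω i) (unpair-pair m n)

  -- From a ceer to admissibility, discreteness, overtness and ideals

  module CeerQuotient {R : Rel ℕ 0ℓ} (isEq : IsEquivalence R) (S : Semidecider R) where

    private
      module R = IsEquivalence isEq
      module S = Semidecider S
      Y = ℕ/ R isEq

    classCode : Code
    classCode = program (oddPart ∷ᵛ evenPart ∷ᵛ S.code ∷ᵛ [])
      (call 2F ⟨ ⟨ call 0F (lit 0) , call 1F (lit 0) ⟩ , var 0F ⟩)

    className : ℕ → Baire
    className m = encode classCode ∷ λ _ → m

    class-accepts : ∀ m → Accepts Y (Coded (className m)) (λ x → R x m)
    class-accepts m p x R₀ = (λ j → S.fun ⟪ ⟪ p 0 , m ⟫ , j ⟫) ,
      Φ⇒Coded classCode (λ _ → m)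
        (Φ-program (⇓readArgument (λ _ → m) p ∷ᵖ Φ-nameTail (λ _ → m) p ∷ᵖ S.total ∷ᵖ [])) ,
      mk⇔ (λ (j , hit) → R.trans (R.sym R₀) (S.sound j hit)) (λ Rxm → S.complete (R.trans R₀ Rxm))

    computablyAdmissible : ComputablyAdmissible em Y
    computablyAdmissible = find , names
      where
      answers find : Code
      -- `right` drops the output position, on which the search does not depend.
      answers = comp (applyName oracle (parameterNames (encode classCode))) right
      find    = comp left (firstHit answers)

      class : ∀ m → ∃[ U ] (𝒪 em Y ∋ className m ⊩ U × (∀ x → _∈ᵒ_ em {X = Y} x U ⇔ R x m))
      class m = openSet Y (λ x≈y → R.trans (R.sym x≈y)) {className m} (class-accepts m)

      names : ∀ p x → 𝒪 em (𝒪 em Y) ∋ p ⊩ neighbourhoods em Y x →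
              ∃[ q ] (Φ find p q × Y ∋ q ⊩ x)
      names p x px = (λ i → π₁ (found i)) , (λ i → ⇓comp (proj₁ (proj₂ (first i))) ⇓left) ,
        R.sym (accepted (π₁ (found 0)) (π₂ (found 0)) (proj₂ (proj₂ (first 0))))
        where
        g : ℕ → Baire
        g m = proj₁ (px (className m) (proj₁ (class m)) (proj₁ (proj₂ (class m))))

        coded : ∀ m → Coded p (className m) (g m)
        coded m = proj₁ (proj₂ (px (className m) (proj₁ (class m)) (proj₁ (proj₂ (class m)))))

        g⊩ : ∀ m → g m ⊩𝕊 Func.to (proj₁ (proj₁ (class m))) x
        g⊩ m = proj₂ (proj₂ (px (className m) (proj₁ (class m)) (proj₁ (proj₂ (class m)))))

        Φ-answers : Φ answers p (uncurry g ∘ π₂)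
        Φ-answers w = ⇓comp ⇓right
          (Φ-applyName {ρ = className} (λ _ → ⇓oracle) Φ-parameterNames coded (π₂ w))

        value : ∀ i m j → (uncurry g ∘ π₂) ⟪ i , ⟪ m , j ⟫ ⟫ ≡ g m j
        value i m j = trans (cong (uncurry g ∘ proj₂) (unpair-pair i ⟪ m , j ⟫)) (uncurry-pair g m j)

        accepted : ∀ m j → g m j ≢ 0 → R x m
        accepted m j hit = Equivalence.to (proj₂ (proj₂ (class m)) x) (⊩𝕊-hit {g m} (g⊩ m) (j , hit))

        own-class : Hits (g x)
        own-class = ⊩𝕊-true (g⊩ x) (Equivalence.from (proj₂ (proj₂ (class x)) x) R.refl)

        first : ∀ i → ∃[ n ] (firstHit answers ⟦ p ⟧ i ⇓ n × uncurry g n ≢ 0)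
        first i =
          let n , halts , hit = ⇓firstHit Φ-answers {m = ⟪ x , proj₁ own-class ⟫}
                (subst (_≢ 0) (sym (value i x (proj₁ own-class))) (proj₂ own-class))
          in n , halts , subst (_≢ 0) (cong (uncurry g ∘ proj₂) (unpair-pair i n)) hit

        found : ℕ → ℕ
        found i = proj₁ (first i)

    module _ {X : RepresentedSpace c ℓ r} (X≅Y : X ≅ Y) where

      open _≅_ X≅Y using (to; from; to-computable; from-computable)
      private
        module F = Inverse (_≅_.inverse X≅Y)
        module X where
          open RepresentedSpace X public
          open Setoid (RepresentedSpace.setoid X) public using (sym; trans)

        to-injective : ∀ {x y} → R (to x) (to y) → x X.≈ y
        to-injective {x} {y} h = X.trans (X.sym (F.strictlyInverseʳ x))
          (X.trans (F.from-cong h) (F.strictlyInverseʳ y))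

      computablyDiscrete : ComputablyDiscrete em X
      computablyDiscrete = Accepts⇒ComputablyOpen (X ⊗ X)
        (λ (x≈x′ , y≈y′) x≈y → X.trans (X.sym x≈x′) (X.trans x≈y y≈y′)) equality accepts
        where
        d equality : Code
        d        = proj₁ to-computable
        equality = program (d ∘ᶜ evenPart ∷ᵛ d ∘ᶜ oddPart ∷ᵛ S.code ∷ᵛ [])
          (call 2F ⟨ ⟨ call 0F (lit 0) , call 1F (lit 0) ⟩ , var 0F ⟩)

        accepts : Accepts (X ⊗ X) (Φ equality) (λ (x , y) → x X.≈ y)
        accepts p (x , y) (px , py) =
          let q  , Φq  , Rx = proj₂ to-computable _ x px
              q′ , Φq′ , Ry = proj₂ to-computable _ y py
          in (λ j → S.fun ⟪ ⟪ q 0 , q′ 0 ⟫ , j ⟫) ,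
             Φ-program (Φ-∘ᶜ (Φ-evenPart p) Φq ∷ᵖ Φ-∘ᶜ (Φ-oddPart p) Φq′ ∷ᵖ S.total ∷ᵖ []) ,
             mk⇔ (λ (j , hit) → to-injective
                   (R.trans (R.sym Rx) (R.trans (S.sound j hit) Ry)))
                 (λ x≈y → S.complete (R.trans Rx (R.trans (F.to-cong x≈y) (R.sym Ry))))

      -- The points `from n` exhaust `X`, so it suffices to ask the given open set about all of them
      -- in parallel.
      computablyOvert : ComputablyOvert em X
      computablyOvert = Accepts⇒ComputablyOpen (𝒪 em X)
        (λ U≈V (x , x∈U) → x , trans (sym (U≈V x)) x∈U) nonempty accepts
        where
        nonempty : Code
        nonempty = applyName oracle (runWith (proj₁ from-computable) pointName)

        name : ∀ n → ∃[ s ] (Φ (proj₁ from-computable) (n ∷ 0ω) s × s X.⊩ from n)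
        name n = proj₂ from-computable (n ∷ 0ω) n R.refl

        accepts : Accepts (𝒪 em X) (Φ nonempty) (λ U → ∃[ x ] _∈ᵒ_ em {X = X} x U)
        accepts q U@(χ , _) qU = uncurry g ,
          Φ-applyName {ρ = proj₁ ∘ name} (λ _ → ⇓oracle)
            (Φ-runWith {f = λ n → n ∷ 0ω} Φ-pointName (λ n → proj₁ (proj₂ (name n))))
            (λ n → proj₁ (proj₂ (answer n))) ,
          mk⇔ (λ (w , hit) → from (π₁ w) , ⊩𝕊-hit (proj₂ (proj₂ (answer (π₁ w)))) (π₂ w , hit))
              inhabited
          where
          answer : ∀ n → ∃[ s ] (Coded q (proj₁ (name n)) s × s ⊩𝕊 Func.to χ (from n))
          answer n = qU (proj₁ (name n)) (from n) (proj₂ (proj₂ (name n)))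

          g : ℕ → Baire
          g n = proj₁ (answer n)

          inhabited : ∃[ x ] _∈ᵒ_ em {X = X} x U → Hits (uncurry g)
          inhabited (x , x∈U) =
            let n = to x
                j , hit = ⊩𝕊-true (proj₂ (proj₂ (answer n)))
                            (trans (Func.cong χ (F.strictlyInverseʳ x)) x∈U)
            in ⟪ n , j ⟫ , subst (_≢ 0) (sym (uncurry-pair g n j)) hit

      -- The ideals of an equivalence relation are its classes.
      precomputablyQuasiPolish : PrecomputablyQuasiPolish em X
      precomputablyQuasiPolish =
        R , R.trans , Semidecider⇒ComputablyEnumerable S , ≅-trans X≅Y Y≅𝐈
        where
        open Ideal

        class : ℕ → Ideal em R
        class n = record
          { members    = λ m → R m n
          ; nonempty   = n , R.refl
          ; downClosed = R.trans
          ; directed   = λ Rxn Ryn → n , R.refl , Rxn , Ryn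
          }

        related : ∀ (I : Ideal em R) {x y} → members I x → members I y → R x y
        related I x∈I y∈I =
          let z , _ , Rxz , Ryz = directed I x∈I y∈I in R.trans Rxz (R.sym Ryz)

        open Listing S

        enumerates : ∀ p n → R (p 0) n → 𝐈 em R ∋ listing (p 0) ⊩ class n
        enumerates p n R₀ m =
          let members⇔ = listing-members R.refl
          in mk⇔ (λ Rmn → Equivalence.to members⇔ (R.trans Rmn (R.sym R₀)))
                 (λ listed → R.trans (Equivalence.from members⇔ listed) R₀)

        Y≅𝐈 : Y ≅ 𝐈 em R
        Y≅𝐈 = record
          { inverse = record
            { to        = class
            ; from      = λ I → proj₁ (nonempty I)
            ; to-cong   = λ Rmn → (λ h → R.trans h Rmn) , (λ h → R.trans h (R.sym Rmn))
            ; from-cong = λ {I} {J} (I⊆J , _) →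
                related J (I⊆J (proj₂ (nonempty I))) (proj₂ (nonempty J))
            ; inverse   =
                (λ {I} h → (λ Rmn → downClosed I (R.trans Rmn h) (proj₂ (nonempty I))) ,
                           (λ m∈I → R.trans (related I m∈I (proj₂ (nonempty I))) (R.sym h))) ,
                (λ {n} {I} (I⊆ , _) → I⊆ (proj₂ (nonempty I)))
            }
          ; to-computable   = listingCode oracle , λ p n R₀ →
              listing (p 0) , Φ-listing (λ _ → ⇓oracle) , enumerates p n R₀
          ; from-computable = oracle , λ p I pI →
              p , (λ _ → ⇓oracle) ,
              related I (Equivalence.from (pI (p 0)) (0 , refl)) (proj₂ (nonempty I))
          }

  -- From a discrete overt space of ideals to a ceer

  module DiscreteOvert
    {X : RepresentedSpace c ℓ r} {_≪_ : Rel ℕ 0ℓ} (≪-trans : Transitive _≪_)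
    (S : Semidecider _≪_) (X≅𝐈 : X ≅ 𝐈 em _≪_)
    (discrete : ComputablyDiscrete em X) (overt : ComputablyOvert em X) where

    open _≅_ X≅𝐈 using (to; from; to-computable; from-computable)
    open Ideal
    private
      module F = Inverse (_≅_.inverse X≅𝐈)
      module S = Semidecider S
      module X where
        open RepresentedSpace X public
        open Setoid (RepresentedSpace.setoid X) public using (refl; sym; trans)
      𝐈≪ = 𝐈 em _≪_
      module 𝐈 where
        open RepresentedSpace 𝐈≪ public
        open Setoid (RepresentedSpace.setoid 𝐈≪) public using (refl; sym; trans; isEquivalence)

    Inhabited : ℕ → Set₁
    Inhabited n = Σ[ I ∈ Ideal em _≪_ ] members I n

    private
      -- Waits for `n` to appear in the enumeration of the ideal. The open sets obtained are uniform
      -- in `n`, so overtness makes `Inhabited` semidecidable.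
      containsCode : Code
      containsCode = program (proj₁ to-computable ∘ᶜ oddPart ∷ᵛ evenPart ∷ᵛ [])
        (apply equal-term (call 0F (var 0F) ∷ᵛ call 1F (lit 0) ∷ᵛ []))

      containsName : ℕ → Baire
      containsName n = encode containsCode ∷ λ _ → n

      contains-accepts : ∀ n → Accepts X (Coded (containsName n)) (λ x → members (to x) n)
      contains-accepts n p x px =
        let q , Φq , q⊩ = proj₂ to-computable p x px
        in (λ j → equal (q j) n) ,
           Φ⇒Coded containsCode (λ _ → n)
             (Φ-program (Φ-∘ᶜ (⇓readArgument (λ _ → n) p) Φq ∷ᵖ Φ-nameTail (λ _ → n) p ∷ᵖ [])) ,
           mk⇔ (λ (j , hit) → Equivalence.from (q⊩ n) (j , equal⇒≡ (q j) n hit))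
               (λ n∈ → let j , eq = Equivalence.to (q⊩ n) n∈
                       in j , subst (λ m → equal m n ≢ 0) (sym eq) (equal-refl n))

      contains : ∀ n → ∃[ U ] (𝒪 em X ∋ containsName n ⊩ U ×
                               (∀ x → _∈ᵒ_ em {X = X} x U ⇔ members (to x) n))
      contains n = openSet X (λ x≈y → proj₁ (F.to-cong x≈y)) {containsName n} (contains-accepts n)

      nonempty-accepts : ∃[ c ] Accepts (𝒪 em X) (Φ c) (λ U → ∃[ x ] _∈ᵒ_ em {X = X} x U)
      nonempty-accepts = ComputablyOpen⇒Accepts (𝒪 em X) overt

      accepted : ∀ n → ∃[ s ] (Φ (proj₁ nonempty-accepts) (containsName n) s ×
                               (Hits s ⇔ (∃[ x ] _∈ᵒ_ em {X = X} x (proj₁ (contains n)))))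
      accepted n = proj₂ nonempty-accepts (containsName n) (proj₁ (contains n))
                     (proj₁ (proj₂ (contains n)))

      opaque
        inhabitedCode : Code
        inhabitedCode = runWith (proj₁ nonempty-accepts) (parameterNames (encode containsCode))

        inhabited : ℕ → Baire
        inhabited n = proj₁ (accepted n)

        Φ-inhabited : ∀ {α} → Φ inhabitedCode α (uncurry inhabited)
        Φ-inhabited =
          Φ-runWith {f = containsName} Φ-parameterNames (λ n → proj₁ (proj₂ (accepted n)))

        inhabited⇔ : ∀ n → Hits (inhabited n) ⇔ Inhabited n
        inhabited⇔ n = mk⇔
          (λ hits → let x , x∈ = Equivalence.to (proj₂ (proj₂ (accepted n))) hits
                    in to x , Equivalence.to (proj₂ (proj₂ (contains n)) x) x∈)
          (λ (I , n∈I) → Equivalence.from (proj₂ (proj₂ (accepted n)))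
            (from I , Equivalence.from (proj₂ (proj₂ (contains n)) (from I))
                        (proj₂ (F.strictlyInverseˡ I) n∈I)))

    Together : Rel ℕ (lsuc 0ℓ)
    Together x y = Σ[ I ∈ Ideal em _≪_ ] (members I x × members I y)

    -- Two numbers lie in a common ideal if and only if they have a common upper
    -- bound that lies in some ideal.
    together : Semidecider Together
    together = record
      { code     = program (S.code ∷ᵛ inhabitedCode ∷ᵛ [])
          (ifZero (call 0F ⟨ ⟨ fst (fst (var 0F)) , bound ⟩ , fst (fst times) ⟩) (lit 0)
            (ifZero (call 0F ⟨ ⟨ snd (fst (var 0F)) , bound ⟩ , snd (fst times) ⟩) (lit 0)
              (call 1F ⟨ bound , snd times ⟩)))
      ; fun      = uncurry fun
      ; total    = Φ-program (S.total ∷ᵖ Φ-inhabited ∷ᵖ [])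
      ; complete = λ {x} {y} (I , x∈I , y∈I) →
          let z , z∈I , x≪z , y≪z = directed I x∈I y∈I
              t₁ , h₁ = S.complete x≪z
              t₂ , h₂ = S.complete y≪z
              t₃ , h₃ = Equivalence.from (inhabited⇔ z) (I , z∈I)
          in ⟪ z , ⟪ ⟪ t₁ , t₂ ⟫ , t₃ ⟫ ⟫ ,
             subst (_≢ 0) (sym (value x y z t₁ t₂ t₃))
               (⇒conj h₁ (⇒conj h₂ (subst (_≢ 0) (sym (uncurry-pair inhabited z t₃)) h₃)))
      ; sound    = λ {x} {y} w hit →
          sound x y (π₁ w) (π₁ (π₁ (π₂ w))) (π₂ (π₁ (π₂ w))) (π₂ (π₂ w))
            (subst (_≢ 0) (fun-pair x y w) hit)
      }
      where
      bound times : Term 2 1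
      bound = fst (snd (var 0F))
      times = snd (snd (var 0F))

      witness : ℕ → ℕ → ℕ → ℕ → ℕ → ℕ → ℕ
      witness x y z t₁ t₂ t₃ = conj (S.fun ⟪ ⟪ x , z ⟫ , t₁ ⟫)
        (conj (S.fun ⟪ ⟪ y , z ⟫ , t₂ ⟫) (uncurry inhabited ⟪ z , t₃ ⟫))

      fun : ℕ → ℕ → ℕ
      fun v = uncurry₄ (witness (π₁ v) (π₂ v))

      fun-pair : ∀ x y w → uncurry fun ⟪ ⟪ x , y ⟫ , w ⟫ ≡ uncurry₄ (witness x y) w
      fun-pair x y w = trans (uncurry-pair fun ⟪ x , y ⟫ w)
        (cong (λ (a , b) → uncurry₄ (witness a b) w) (unpair-pair x y))

      value : ∀ x y z t₁ t₂ t₃ →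
        uncurry fun ⟪ ⟪ x , y ⟫ , ⟪ z , ⟪ ⟪ t₁ , t₂ ⟫ , t₃ ⟫ ⟫ ⟫ ≡ witness x y z t₁ t₂ t₃
      value x y z t₁ t₂ t₃ =
        trans (fun-pair x y ⟪ z , ⟪ ⟪ t₁ , t₂ ⟫ , t₃ ⟫ ⟫) (uncurry₄-pair (witness x y) z t₁ t₂ t₃)

      sound : ∀ x y z t₁ t₂ t₃ → witness x y z t₁ t₂ t₃ ≢ 0 → Together x y
      sound x y z t₁ t₂ t₃ hit =
        let h₁ , h′ = conj⇒ {S.fun ⟪ ⟪ x , z ⟫ , t₁ ⟫} hit
            h₂ , h₃ = conj⇒ {S.fun ⟪ ⟪ y , z ⟫ , t₂ ⟫} h′
            I , z∈I = Equivalence.to (inhabited⇔ z)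
                        (t₃ , subst (_≢ 0) (uncurry-pair inhabited z t₃) h₃)
        in I , downClosed I (S.sound t₁ h₁) z∈I , downClosed I (S.sound t₂ h₂) z∈I

    private
      opaque
        equality : ∃[ e ] Accepts (𝐈≪ ⊗ 𝐈≪) (Φ e) (λ (I , J) → I 𝐈.≈ J)
        equality = e ∘ᶜ interleaveCode (d ∘ᶜ evenPart) (d ∘ᶜ oddPart) , accepts
          where
          e d : Code
          e = proj₁ (ComputablyOpen⇒Accepts (X ⊗ X) discrete)
          d = proj₁ from-computable

          accepts : Accepts (𝐈≪ ⊗ 𝐈≪) (Φ (e ∘ᶜ interleaveCode (d ∘ᶜ evenPart) (d ∘ᶜ oddPart)))
                      (λ (I , J) → I 𝐈.≈ J)
          accepts p (I , J) (pI , pJ) =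
            let q  , Φq  , qI = proj₂ from-computable _ I pI
                q′ , Φq′ , qJ = proj₂ from-computable _ J pJ
                s , Φs , hits = proj₂ (ComputablyOpen⇒Accepts (X ⊗ X) discrete)
                  (interleave q q′) (from I , from J)
                  (X.⊩-resp (λ n → sym (interleave-even q q′ n)) X.refl qI ,
                   X.⊩-resp (λ n → sym (interleave-odd q q′ n)) X.refl qJ)
            in s ,
               Φ-∘ᶜ (Φ-interleaveCode (Φ-∘ᶜ (Φ-evenPart p) Φq) (Φ-∘ᶜ (Φ-oddPart p) Φq′)) Φs ,
               mk⇔ (λ h → 𝐈.trans {I} {to (from I)} {J}
                      (𝐈.sym {to (from I)} {I} (F.strictlyInverseˡ I))
                      (𝐈.trans {to (from I)} {to (from J)} {J} (F.to-cong (Equivalence.to hits h))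
                        (F.strictlyInverseˡ J)))
                   (λ I≈J → Equivalence.from hits (F.from-cong I≈J))

      E : Code
      E = proj₁ equality

      accepts-interleave : ∀ {p q I J} → 𝐈≪ ∋ p ⊩ I → 𝐈≪ ∋ q ⊩ J →
                           ∃[ s ] (Φ E (interleave p q) s × (Hits s ⇔ I 𝐈.≈ J))
      accepts-interleave {p} {q} {I} {J} pI qJ = proj₂ equality (interleave p q) (I , J)
        (𝐈.⊩-resp {x = I} {y = I} (λ n → sym (interleave-even p q n)) (𝐈.refl {I}) pI ,
         𝐈.⊩-resp {x = J} {y = J} (λ n → sym (interleave-odd p q n)) (𝐈.refl {J}) qJ)

      -- Lists are nested pairs without an end marker: every number codes an infinite sequence, and
      -- every finite sequence is an initial part of one.
      element-term : Term k 2
      element-term = fst (loop (var 0F) (var 1F) (snd (var 0F)))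

      element : ℕ → ℕ → ℕ
      element i w = sem [] element-term (i ∷ᵛ w ∷ᵛ [])

      element-suc : ∀ i x w → element (suc i) ⟪ x , w ⟫ ≡ element i w
      element-suc i x w = cong π₁ (trans (commute i ⟪ x , w ⟫)
        (cong (λ (_ , v) → natrec i v (λ _ → π₂)) (unpair-pair x w)))
        where
        commute : ∀ i v → π₂ (natrec i v (λ _ → π₂)) ≡ natrec i (π₂ v) (λ _ → π₂)
        commute zero    v = refl
        commute (suc i) v = cong π₂ (commute i v)

      list : (b : ℕ → ℕ) → ∀ u → ∃[ w ] (∀ i → i < u → element i w ≡ b i)
      list b zero    = 0 , λ _ ()
      list b (suc u) =
        let w , elements = list (b ∘ suc) u in ⟪ b 0 , w ⟫ , λ
          { zero    _         → cong proj₁ (unpair-pair (b 0) w)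
          ; (suc i) (s≤s i<u) → trans (element-suc i (b 0) w) (elements i i<u) }

      -- Entry i is m if entry i of the list w is ⟪ m , t ⟫ and t witnesses m ≪ n,
      -- and n otherwise; so all entries lie in every ideal that contains n.
      below : ℕ → ℕ → ℕ → ℕ
      below n w i = if0 (S.fun ⟪ ⟪ π₁ (element i w) , n ⟫ , π₂ (element i w) ⟫) n (π₁ (element i w))

      below-hit : ∀ n w i {m t} → element i w ≡ ⟪ m , t ⟫ → S.fun ⟪ ⟪ m , n ⟫ , t ⟫ ≢ 0 →
                  below n w i ≡ m
      below-hit n w i {m} {t} eq hit =
        trans (cong (λ v → if0 (S.fun ⟪ ⟪ π₁ v , n ⟫ , π₂ v ⟫) n (π₁ v)) eq)
          (trans (cong (λ (x , y) → if0 (S.fun ⟪ ⟪ x , n ⟫ , y ⟫) n x) (unpair-pair m t))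
                 (if0-≢0 (S.fun ⟪ ⟪ m , n ⟫ , t ⟫) hit))

      below-member : ∀ {n} w i (I : Ideal em _≪_) → members I n → members I (below n w i)
      below-member {n} w i I n∈I
        with S.fun ⟪ ⟪ π₁ (element i w) , n ⟫ , π₂ (element i w) ⟫ in eq
      ... | zero  = n∈I
      ... | suc _ = downClosed I (S.sound (π₂ (element i w)) (suc⇒≢0 eq)) n∈I

      -- With `z` = ⟪ n , w ⟫, halving the position interleaves `below n w` with itself: the
      -- beginning of a would-be name of a pair of equal ideals.
      trial : ℕ → Baire
      trial z i = below (π₁ z) (π₂ z) (half i)

      trialCode : Code
      trialCode = program (S.code ∷ᵛ [])
        (ifZero (call 0F ⟨ ⟨ fst e , fst z ⟩ , snd e ⟩) (fst z) (fst e))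
        where
        z e : Term 1 1
        z = fst (var 0F)
        e = apply element-term (apply half-term (snd (var 0F) ∷ᵛ []) ∷ᵛ snd z ∷ᵛ [])

      Φ-trial : ∀ {α} → Φ trialCode α (uncurry trial)
      Φ-trial = Φ-program (S.total ∷ᵖ [])

      trial-interleave : ∀ n w i → trial ⟪ n , w ⟫ i ≡ interleave (below n w) (below n w) i
      trial-interleave n w i = trans (cong (λ (a , b) → below a b (half i)) (unpair-pair n w))
        (sym (interleave-diagonal (below n w) i))

      splice : ℕ → Baire → Baire → Baire
      splice u p q i with i <? u
      ... | yes _ = p i
      ... | no  _ = q (i ∸ u)

      splice-Agree : ∀ u p q → Agree u p (splice u p q)
      splice-Agree u p q i i<u with i <? u
      ... | yes _  = refl
      ... | no i≮u = contradiction i<u i≮u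

      -- Names of ideals allow repetitions, so members may be put in front, and `q` is delayed
      -- without losing an entry.
      splice-⊩ : ∀ u {p q I} → (∀ i → members I (p i)) → 𝐈≪ ∋ q ⊩ I → 𝐈≪ ∋ splice u p q ⊩ I
      splice-⊩ u {p} {q} {I} p∈I qI n = mk⇔
        (λ n∈I → let i , eq = Equivalence.to (qI n) n∈I in u + i , trans (shifted i) eq)
        (λ { (i , refl) → member i })
        where
        shifted : ∀ i → splice u p q (u + i) ≡ q i
        shifted i with u + i <? u
        ... | yes lt = contradiction lt (≤⇒≯ (m≤m+n u i))
        ... | no  _  = cong q (m+n∸m≡n u i)

        member : ∀ i → members I (splice u p q i)
        member i with i <? u
        ... | yes _ = p∈I i
        ... | no  _ = Equivalence.from (qI (q (i ∸ u))) (i ∸ u , refl)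

      -- Acceptance of a trial depends on finitely many of its entries, and these
      -- extend to names of any two ideals that contain n.
      trial-unique : ∀ {n w j v} → E ⟦ trial ⟪ n , w ⟫ ⟧ j ⇓ suc v →
                     ∀ I J → members I n → members J n → I 𝐈.≈ J
      trial-unique {n} {w} {j} h I J n∈I n∈J =
        let h′ = ⇓-resp (trial-interleave n w) h
            u , use = ⇓-finite-use h′
            p , pI  = 𝐈.⊩-surjective I
            q , qJ  = 𝐈.⊩-surjective J
            s , Φs , hits = accepts-interleave {I = I} {J = J}
              (splice-⊩ u {I = I} (λ i → below-member w i I n∈I) pI)
              (splice-⊩ u {I = J} (λ i → below-member w i J n∈J) qJ)
            agree = Agree-interleave u (splice-Agree u (below n w) p) (splice-Agree u (below n w) q)
        in Equivalence.to hits (j , suc⇒≢0 (⇓-deterministic (Φs j) (use agree)))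

      -- Directedness bounds two members at a time; transitivity carries the earlier bounds along.
      upperBound : ∀ (I : Ideal em _≪_) (p : Baire) u → (∀ i → members I (p i)) →
                   ∃[ n ] (members I n × (∀ i → i < u → p i ≪ n))
      upperBound I p zero    p∈I = proj₁ (nonempty I) , proj₂ (nonempty I) , λ _ ()
      upperBound I p (suc u) p∈I =
        let n , n∈I , bound   = upperBound I p u p∈I
            z , z∈I , n≪z , p≪z = directed I n∈I (p∈I u)
        in z , z∈I , λ i i<1+u → extend bound n≪z p≪z (m≤n⇒m<n∨m≡n (s≤s⁻¹ i<1+u))
        where
        extend : ∀ {n z i} → (∀ i → i < u → p i ≪ n) → n ≪ z → p u ≪ z → i < u ⊎ i ≡ u → p i ≪ z
        extend bound n≪z p≪z (inj₁ i<u)  = ≪-trans (bound _ i<u) n≪z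
        extend bound n≪z p≪z (inj₂ refl) = p≪z

      -- The equality test accepts the pair of `I` with itself after reading `u` entries of each
      -- name. An upper bound `n` of these entries inside `I`, with the times that confirm the
      -- relations, turns the part read into a trial.
      trial-exists : ∀ (I : Ideal em _≪_) →
        ∃[ n ] ∃[ w ] ∃[ j ] ∃[ v ] (members I n × E ⟦ trial ⟪ n , w ⟫ ⟧ j ⇓ suc v)
      trial-exists I =
        let p , pI = 𝐈.⊩-surjective I
            p∈I : ∀ i → members I (p i)
            p∈I i = Equivalence.from (pI (p i)) (i , refl)
            s , Φs , hits = accepts-interleave {I = I} {J = I} pI pI
            j , hit = Equivalence.from hits (𝐈.refl {I})
            v , eq  = ≢0⇒suc hit
            u , use = ⇓-finite-use (⇓-cast eq (Φs j))
            n , n∈I , bound = upperBound I p u p∈I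
            times : ∀ i → ∃[ t ] (i < u → S.fun ⟪ ⟪ p i , n ⟫ , t ⟫ ≢ 0)
            times i = time i p n bound
            w , elements = list (λ i → ⟪ p i , proj₁ (times i) ⟫) u
            agree : Agree u p (below n w)
            agree i i<u = sym (below-hit n w i (elements i i<u) (proj₂ (times i) i<u))
        in n , w , j , v , n∈I ,
           ⇓-resp (λ i → sym (trial-interleave n w i)) (use (Agree-interleave u agree agree))
        where
        time : ∀ {u} i (p : Baire) n → (∀ i → i < u → p i ≪ n) →
               ∃[ t ] (i < u → S.fun ⟪ ⟪ p i , n ⟫ , t ⟫ ≢ 0)
        time {u} i p n bound with i <? u
        ... | yes i<u = map₂ (λ hit _ → hit) (S.complete (bound i i<u))
        ... | no  i≮u = 0 , λ i<u → contradiction i<u i≮u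

    -- Says that `I` is the only point of the basic open set of ideals that contain `n`.
    Isolates : ℕ → Ideal em _≪_ → Set₁
    Isolates n I = members I n × (∀ J → members J n → J 𝐈.≈ I)

    private
      opaque
        -- An accepted trial shows only that at most one ideal contains `π₁ z`; the second factor
        -- confirms that there is one. Since `evaluation` gives the successor of an output, `pred`
        -- leaves zero both for a run that has not halted and for the output zero.
        certificate : ℕ → ℕ → ℕ → ℕ → ℕ
        certificate z j s t = conj (pred (evaluation (uncurry trial) ⟪ ⟪ z , ⟪ encode E , j ⟫ ⟫ , s ⟫))
          (uncurry inhabited ⟪ π₁ z , t ⟫)

        certificateCode : Code
        certificateCode = program (evaluator trialCode ∷ᵛ inhabitedCode ∷ᵛ [])
          (ifZero (dec (call 0F ⟨ ⟨ z , ⟨ lit (encode E) , j ⟩ ⟩ , s ⟩)) (lit 0)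
                  (call 1F ⟨ fst z , t ⟩))
          where
          z j s t : Term 2 1
          z = fst (var 0F)
          j = fst (fst (snd (var 0F)))
          s = snd (fst (snd (var 0F)))
          t = snd (snd (var 0F))

        Φ-certificate : ∀ {α} → Φ certificateCode α (uncurry₄ certificate)
        Φ-certificate = Φ-program (Φ-evaluator Φ-trial ∷ᵖ Φ-inhabited ∷ᵖ [])

        certificate-sound : ∀ z j s t → certificate z j s t ≢ 0 → ∃ (Isolates (π₁ z))
        certificate-sound z j s t h =
          let h₁ , h₂ = conj⇒ {pred (evaluation (uncurry trial) ⟪ ⟪ z , ⟪ encode E , j ⟫ ⟫ , s ⟫)} h
              v , eq  = pred≢0 h₁
              run     = evaluation-encode-sound trial z E s eq
              I , n∈I = Equivalence.to (inhabited⇔ (π₁ z))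
                          (t , subst (_≢ 0) (uncurry-pair inhabited (π₁ z) t) h₂)
          in I , n∈I , λ J n∈J → trial-unique
               (subst (λ y → E ⟦ trial y ⟧ j ⇓ suc v) (sym (pair-unpair z)) run) J I n∈J n∈I
          where
          pred≢0 : ∀ {n} → pred n ≢ 0 → ∃[ v ] n ≡ suc (suc v)
          pred≢0 {zero}        h = contradiction refl h
          pred≢0 {suc zero}    h = contradiction refl h
          pred≢0 {suc (suc v)} h = v , refl

        certificate-complete : ∀ (I : Ideal em _≪_) →
          ∃[ z ] ∃[ j ] ∃[ s ] ∃[ t ] (members I (π₁ z) × certificate z j s t ≢ 0)
        certificate-complete I =
          let n , w , j , v , n∈I , run = trial-exists I
              z      = ⟪ n , w ⟫
              s , eq = evaluation-encode-complete trial z E run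
              n≡π₁z  = sym (cong proj₁ (unpair-pair n w))
              π₁z∈I  = subst (members I) n≡π₁z n∈I
              t , h  = Equivalence.from (inhabited⇔ (π₁ z)) (I , π₁z∈I)
          in z , j , s , t , π₁z∈I ,
             ⇒conj (suc⇒≢0 (cong pred eq)) (subst (_≢ 0) (sym (uncurry-pair inhabited (π₁ z) t)) h)

    opaque
      -- Quadruples that are no certificates are sent to a default, which comes from `I₀`. Some
      -- ideal has to be given: a relation without ideals yields the empty space, which is discrete
      -- and overt, while a quotient of ℕ has a point.
      isolating : Ideal em _≪_ → Σ[ f ∈ (ℕ → ℕ) ] ∃[ c ] ((∀ {α} → Φ c α f) ×
                    (∀ i → ∃ (Isolates (f i))) × (∀ (I : Ideal em _≪_) → ∃[ i ] members I (f i)))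
      isolating I₀ = f , code , Φ-program (Φ-certificate ∷ᵖ []) , isolates , covers
        where
        default : ℕ
        default = π₁ (proj₁ (certificate-complete I₀))

        default-isolates : ∃ (Isolates default)
        default-isolates =
          let z , j , s , t , _ , h = certificate-complete I₀ in certificate-sound z j s t h

        choose : ℕ → ℕ → ℕ → ℕ → ℕ
        choose z j s t = if0 (certificate z j s t) default (π₁ z)

        f : ℕ → ℕ
        f = uncurry₄ choose

        code : Code
        code = program (certificateCode ∷ᵛ [])
          (ifZero (call 0F (var 0F)) (lit default) (fst (fst (var 0F))))

        choose-isolates : ∀ z j s t → ∃ (Isolates (choose z j s t))
        choose-isolates z j s t = cases (certificate z j s t) (certificate-sound z j s t)
          where
          cases : ∀ b → (b ≢ 0 → ∃ (Isolates (π₁ z))) → ∃ (Isolates (if0 b default (π₁ z)))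
          cases zero    _ = default-isolates
          cases (suc _) h = h (λ ())

        isolates : ∀ i → ∃ (Isolates (f i))
        isolates i = choose-isolates (π₁ i) (π₁ (π₁ (π₂ i))) (π₂ (π₁ (π₂ i))) (π₂ (π₂ i))

        covers : ∀ (I : Ideal em _≪_) → ∃[ i ] members I (f i)
        covers I =
          let z , j , s , t , z∈I , h = certificate-complete I
          in ⟪ z , ⟪ ⟪ j , s ⟫ , t ⟫ ⟫ ,
             subst (members I)
               (sym (trans (uncurry₄-pair choose z j s t) (if0-≢0 (certificate z j s t) h))) z∈I

    module Quotient (T : Semidecider Together) (f : ℕ → ℕ) (f-code : Code)
                    (Φf : ∀ {α} → Φ f-code α f) (isolates : ∀ i → ∃ (Isolates (f i)))
                    (covers : ∀ (I : Ideal em _≪_) → ∃[ i ] members I (f i)) where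

      private
        module T = Semidecider T

      point : ℕ → Ideal em _≪_
      point i = proj₁ (isolates i)

      point∋ : ∀ i → members (point i) (f i)
      point∋ i = proj₁ (proj₂ (isolates i))

      point-unique : ∀ i J → members J (f i) → J 𝐈.≈ point i
      point-unique i = proj₂ (proj₂ (isolates i))

      -- Comparing the isolated ideals keeps the relation at level zero; the equivalent `Together`
      -- of the isolating numbers quantifies over ideals and lives one level higher.
      R : Rel ℕ 0ℓ
      R = 𝐈._≈_ on point

      R-isEquivalence : IsEquivalence R
      R-isEquivalence = On.isEquivalence point 𝐈.isEquivalence

      Together⇒R : ∀ {i j} → Together (f i) (f j) → R i j
      Together⇒R {i} {j} (I , i∈I , j∈I) = 𝐈.trans {point i} {I} {point j}
        (𝐈.sym {I} {point i} (point-unique i I i∈I)) (point-unique j I j∈I)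

      R-semidecider : Semidecider R
      R-semidecider = record
        { code     = program (f-code ∷ᵛ T.code ∷ᵛ [])
            (call 1F ⟨ ⟨ call 0F (fst (fst (var 0F))) , call 0F (snd (fst (var 0F))) ⟩ ,
                       snd (var 0F) ⟩)
        ; fun      = uncurry fun
        ; total    = Φ-program (Φf ∷ᵖ T.total ∷ᵖ [])
        ; complete = λ {i} {j} Rij →
            let t , hit = T.complete (point j , proj₁ Rij (point∋ i) , point∋ j)
            in t , subst (_≢ 0) (sym (value i j t)) hit
        ; sound    = λ {i} {j} t hit → Together⇒R (T.sound t (subst (_≢ 0) (value i j t) hit))
        }
        where
        fun : ℕ → ℕ → ℕ
        fun v t = T.fun ⟪ ⟪ f (π₁ v) , f (π₂ v) ⟫ , t ⟫

        value : ∀ i j t → uncurry fun ⟪ ⟪ i , j ⟫ , t ⟫ ≡ T.fun ⟪ ⟪ f i , f j ⟫ , t ⟫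
        value i j t = trans (uncurry-pair fun ⟪ i , j ⟫ t)
          (cong (λ (x , y) → T.fun ⟪ ⟪ f x , f y ⟫ , t ⟫) (unpair-pair i j))

      private
        open Listing T

        -- Only one ideal contains an isolating number, so the members of that ideal are the numbers
        -- that share some ideal with it.
        listing-⊩ : ∀ (p : Baire) i → R (p 0) i → 𝐈≪ ∋ listing (f (p 0)) ⊩ point i
        listing-⊩ p i R₀ m = mk⇔
          (λ m∈ → Equivalence.to members⇔ (point (p 0) , proj₂ R₀ m∈ , point∋ (p 0)))
          (λ listed →
            let I , m∈I , p∈I = Equivalence.from members⇔ listed
            in proj₁ R₀ (proj₁ (point-unique (p 0) I p∈I) m∈I))
          where
          members⇔ : Together m (f (p 0)) ⇔ (∃[ k ] listing (f (p 0)) k ≡ m)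
          members⇔ = listing-members (point (p 0) , point∋ (p 0) , point∋ (p 0))

        candidates find : Code
        candidates = program (oracle ∷ᵛ f-code ∷ᵛ [])
          (apply equal-term (call 0F (snd (snd (var 0F))) ∷ᵛ call 1F (fst (snd (var 0F))) ∷ᵛ []))
        find = comp left (firstHit candidates)

        -- The search may stop at another index than that of `covers I`, but both isolate `I`, so
        -- they are related.
        find-⊩ : ∀ p I → 𝐈≪ ∋ p ⊩ I → ∃[ q ] (Φ find p q × R (q 0) (proj₁ (covers I)))
        find-⊩ p I pI = (λ x → π₁ (proj₁ (first x))) ,
          (λ x → ⇓comp (proj₁ (proj₂ (first x))) ⇓left) ,
          Together⇒R (I , member 0 , proj₂ (covers I))
          where
          match : ℕ → ℕ → ℕ
          match i j = equal (p j) (f i)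

          Φ-candidates : Φ candidates p (uncurry match ∘ π₂)
          Φ-candidates = Φ-program ((λ _ → ⇓oracle) ∷ᵖ Φf ∷ᵖ [])

          first : ∀ x → ∃[ v ] (firstHit candidates ⟦ p ⟧ x ⇓ v ×
                                (uncurry match ∘ π₂) ⟪ x , v ⟫ ≢ 0)
          first x =
            let i , i∈I = covers I
                j , eq  = Equivalence.to (pI (f i)) i∈I
            in ⇓firstHit Φ-candidates {m = ⟪ i , j ⟫} (subst (_≢ 0)
                 (sym (trans (cong (uncurry match ∘ proj₂) (unpair-pair x ⟪ i , j ⟫))
                   (trans (uncurry-pair match i j) (cong (λ y → equal y (f i)) eq))))
                 (equal-refl (f i)))

          member : ∀ x → members I (f (π₁ (proj₁ (first x))))
          member x =
            let v , _ , hit = first x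
            in Equivalence.from (pI (f (π₁ v))) (π₂ v , equal⇒≡ (p (π₂ v)) (f (π₁ v))
                 (subst (_≢ 0) (cong (uncurry match ∘ proj₂) (unpair-pair x v)) hit))

      𝐈≅ℕ/R : 𝐈≪ ≅ ℕ/ R R-isEquivalence
      𝐈≅ℕ/R = record
        { inverse = record
          { to        = λ I → proj₁ (covers I)
          ; from      = point
          ; to-cong   = λ {I} {J} I≈J →
              Together⇒R (J , proj₁ I≈J (proj₂ (covers I)) , proj₂ (covers J))
          ; from-cong = λ Rij → Rij
          ; inverse   =
              (λ {i} {I} I≈ → Together⇒R (point i , proj₁ I≈ (proj₂ (covers I)) , point∋ i)) ,
              (λ {I} {i} R₀ → 𝐈.trans {point i} {point (proj₁ (covers I))} {I} R₀
                (𝐈.sym {I} {point (proj₁ (covers I))}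
                  (point-unique (proj₁ (covers I)) I (proj₂ (covers I)))))
          }
        ; to-computable   = find , find-⊩
        ; from-computable = listingCode (comp f-code oracle) , λ p i R₀ →
            listing (f (p 0)) , Φ-listing (λ j → ⇓comp ⇓oracle (Φf (p j))) , listing-⊩ p i R₀
        }

    ceer : Carrier X → Σ[ R ∈ Rel ℕ 0ℓ ] Σ[ isEq ∈ IsEquivalence R ]
                         (ComputablyEnumerable R × X ≅ ℕ/ R isEq)
    ceer x =
      let f , f-code , Φf , isolates , covers = isolating (to x)
          open Quotient together f f-code Φf isolates covers
      in R , R-isEquivalence , Semidecider⇒ComputablyEnumerable R-semidecider ,
         ≅-trans X≅𝐈 𝐈≅ℕ/R

corollary15 : (em : ∀ {a} → ExcludedMiddle a) →
    ∀ {c ℓ r} (X : RepresentedSpace c ℓ r) → RepresentedSpace.Carrier X →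
    ((ComputablyDiscrete em X × ComputablyQuasiPolish em X) ⇔
    (Σ[ R ∈ Rel ℕ 0ℓ ] Σ[ isEq ∈ IsEquivalence R ]
    (ComputablyAdmissible em (ℕ/ R isEq) × X ≅ ℕ/ R isEq))) ×
    ((Σ[ R ∈ Rel ℕ 0ℓ ] Σ[ isEq ∈ IsEquivalence R ]
    (ComputablyAdmissible em (ℕ/ R isEq) × X ≅ ℕ/ R isEq)) ⇔
    (Σ[ R ∈ Rel ℕ 0ℓ ] Σ[ isEq ∈ IsEquivalence R ]
    (ComputablyEnumerable R × X ≅ ℕ/ R isEq)))
corollary15 em X x =
  mk⇔ (ceer⇒admissible ∘ quasiPolish⇒ceer) (ceer⇒quasiPolish ∘ admissible⇒ceer) ,
  mk⇔ admissible⇒ceer ceer⇒admissible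
  where
  open Classical em

  Admissible Ceer : Set _
  Admissible = Σ[ R ∈ Rel ℕ 0ℓ ] Σ[ isEq ∈ IsEquivalence R ]
    (ComputablyAdmissible em (ℕ/ R isEq) × X ≅ ℕ/ R isEq)
  Ceer = Σ[ R ∈ Rel ℕ 0ℓ ] Σ[ isEq ∈ IsEquivalence R ] (ComputablyEnumerable R × X ≅ ℕ/ R isEq)

  admissible⇒ceer : Admissible → Ceer
  admissible⇒ceer (R , isEq , admissible , X≅) =
    R , isEq , Semidecider⇒ComputablyEnumerable (AdmissibleQuotient.semidecider isEq admissible) , X≅

  ceer⇒admissible : Ceer → Admissible
  ceer⇒admissible (R , isEq , enumerable , X≅) = R , isEq ,
    CeerQuotient.computablyAdmissible isEq (ComputablyEnumerable⇒Semidecider enumerable) , X≅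

  ceer⇒quasiPolish : Ceer → ComputablyDiscrete em X × ComputablyQuasiPolish em X
  ceer⇒quasiPolish (R , isEq , enumerable , X≅) =
    computablyDiscrete X≅ , precomputablyQuasiPolish X≅ , computablyOvert X≅
    where open CeerQuotient isEq (ComputablyEnumerable⇒Semidecider enumerable)

  quasiPolish⇒ceer : ComputablyDiscrete em X × ComputablyQuasiPolish em X → Ceer
  quasiPolish⇒ceer (discrete , (_ , ≪-trans , enumerable , X≅𝐈) , overt) =
    DiscreteOvert.ceer ≪-trans (ComputablyEnumerable⇒Semidecider enumerable) X≅𝐈 discrete overt x
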